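{- For every integer $k\geq 6$, the odd graph $O_k=K(2k+1,k)$ has at least $2^{2^{k-6}}$ distinct Hamilton cycles.
   Context: For integers $k\geq 1$ and $n\geq 2k+1$, the Kneser graph $K(n,k)$ is the graph whose vertices are the $k$-element subsets of $[n]=\{1,\ldots,n\}$, two subsets being adjacent if and only if they are disjoint. The odd graph is $O_k:=K(2k+1,k)$. -}

module Defs where

open import Data.Nat using (ℕ; suc; _+_; _*_)
open import Data.Fin using (Fin)
open import Data.Fin.Subset using (Subset; ∣_∣; _∩_; ⊥)
open import Data.List using (List; []; _∷_; zip; _++_; [_])
open import Data.List.Membership.Propositional using (_∈_)
open import Data.List.Relation.Unary.All using (All)
open import Data.List.Relation.Unary.Unique.Propositional using (Unique)
open import Data.Product using (_×_; _,_; uncurry)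
open import Data.Sum using (_⊎_)
open import Relation.Binary.PropositionalEquality using (_≡_)

IsVertex : (n k : ℕ) → Subset n → Set
IsVertex n k s = ∣ s ∣ ≡ k

Adjacent : {n : ℕ} → Subset n → Subset n → Set
Adjacent s t = s ∩ t ≡ ⊥

cyclePairs : {A : Set} → List A → List (A × A)
cyclePairs []       = []
cyclePairs (x ∷ xs) = zip (x ∷ xs) (xs ++ [ x ])

record HamiltonCycle (n k : ℕ) : Set where
  field
    seq      : List (Subset n)
    vertices : All (IsVertex n k) seq
    unique   : Unique seq
    covers   : (s : Subset n) → IsVertex n k s → s ∈ seq
    adjacent : All (uncurry Adjacent) (cyclePairs seq)
open HamiltonCycle public

UsesEdge : {n k : ℕ} → HamiltonCycle n k → Subset n → Subset n → Set
UsesEdge C u v = ((u , v) ∈ cyclePairs (seq C)) ⊎ ((v , u) ∈ cyclePairs (seq C))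

-- Two Hamilton cycles are the same cycle iff they use the same edges
-- (this identifies rotations and reversals of the vertex sequence).
SameCycle : {n k : ℕ} → HamiltonCycle n k → HamiltonCycle n k → Set
SameCycle C D = ∀ u v → (UsesEdge C u v → UsesEdge D u v) × (UsesEdge D u v → UsesEdge C u v)

oddN : ℕ → ℕ
oddN k = suc (2 * k)

{-# OPTIONS --safe #-}
module Submission where

-- Prepend a bit to a string of length 2k: the odd graph O_k consists of the
-- levels k and k+1 of the 2k-cube (a string s of the lower level is the vertex
-- 0s, a string t of the upper level is 1 followed by the complement of t),
-- together with the edges joining complementary strings of level k.
-- Every Dyck word x starts a path through the two levels that flips each bit
-- once and ends at the complement of x; these paths partition the vertices, so
-- closing each of them by the edge from the complement of x to x gives one
-- cycle of length 2k+1 per Dyck word.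
--
-- An alternating 6-cycle or 8-cycle that meets 3 or 4 different cycles in one
-- edge each merges them.  The path of 1u0v runs through a mirrored copy of the
-- path of the reverse complement of u and then through a copy of the path of v,
-- so merging patterns for u and for v carry over to 1u0v, and all Dyck words can
-- be merged by induction on k: a pattern for the words u that leaves two halves
-- is enough, as a 6-cycle joins both halves of the words 1u0v with |u| = 2j to
-- the words with |u| = 2j-2, and one 8-cycle then brings in the words 10v.  There
-- is no pattern for k = 2, O_2 being the Petersen graph.
--
-- The pattern for k contains one pattern for k-1 among the words 10v and,
-- independently, one among the words 1u0, so the number of free binary choices
-- doubles with k.  Every choice is visible in the Hamilton cycle as the presence
-- or absence of one fixed edge.

open import Defs
open import Data.Bool using (Bool; true; false; not; _∧_)
open import Data.Bool.Properties using (not-involutive; not-injective)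
open import Data.Empty using (⊥; ⊥-elim)
open import Data.Fin using (Fin; zero; suc; remQuot; combine)
open import Data.Fin.Properties using (combine-remQuot)
open import Data.Fin.Subset using (Subset; ∣_∣; _∩_)
import Data.Fin.Subset as Subset
open import Data.List using (List; []; _∷_; _++_; map; length; _ʳ++_; reverse; zip; [_])
open import Data.List.Membership.Propositional using (_∈_; _∉_)
open import Data.List.Membership.Propositional.Properties using (∈-map⁺; ∈-map⁻; ∈-++⁺ˡ; ∈-++⁺ʳ; ∈-++⁻)
open import Data.List.Properties using (++-assoc; ++-identityʳ; ++-cancelʳ; map-injective; ʳ++-defn; ʳ++-ʳ++; map-ʳ++; length-++; length-map; length-ʳ++; unfold-reverse; reverse-involutive; reverse-injective; ∷-injectiveʳ)
open import Data.List.Relation.Unary.All using (All; []; _∷_)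
import Data.List.Relation.Unary.All as All
open import Data.List.Relation.Unary.AllPairs using ([]; _∷_)
open import Data.List.Relation.Unary.Any using (here; there)
import Data.List.Relation.Unary.Any.Properties as Any
open import Data.List.Relation.Unary.Unique.Propositional using (Unique)
import Data.List.Relation.Unary.Unique.Propositional.Properties as Unique
open import Data.Maybe using (Maybe; just; nothing)
open import Data.Maybe.Properties using (just-injective)
open import Data.Nat using (ℕ; zero; suc; _+_; _*_; _^_; _∸_; _≤_; _<_; z≤n; s≤s)
open import Data.Nat.Properties using (+-comm; +-assoc; +-suc; +-identityʳ; +-cancelˡ-≡; ^-distribˡ-+-*; suc-injective; ≤-refl; ≤-reflexive; ≤-trans; ≤-antisym; <⇒≤; <-irrefl; n≤1+n; m≤m+n; m≤n+m; m≤n⇒m<n∨m≡n)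
open import Data.Nat.Solver using (module +-*-Solver)
open import Data.Product using (Σ; ∃; _×_; _,_; proj₁; proj₂; uncurry)
open import Data.Sum using (_⊎_; inj₁; inj₂; [_,_]′)
import Data.Sum as Sum
open import Data.Unit using (⊤; tt)
open import Data.Vec using (Vec; []; _∷_; toList)
open import Function using (id; case_of_)
open import Relation.Binary.PropositionalEquality using (_≡_; _≢_; refl; sym; trans; cong; cong₂; subst; subst₂; subst-injective)
open import Relation.Nullary using (¬_)

-- Dyck words and the paths they start.

Str : Set
Str = List Bool

-- A tree stands for the Dyck word given by word below: node u v is 1u'0v with
-- u' the reverse complement of u.  Storing u mirrored makes both recursive calls
-- of path run forward.
data Dyck : Set where
  leaf : Dyck
  node : Dyck → Dyck → Dyck

size : Dyck → ℕ
size leaf       = 0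
size (node u v) = suc (size u + size v)

word : Dyck → Str
word leaf       = []
word (node u v) = true ∷ (map not (word u) ʳ++ (false ∷ word v))

-- false marks the lower level, true the upper one.
Vertex : Set
Vertex = Bool × Str

-- Along `path (node u v)` the separating 0 is flipped first, then the middle block, then the
-- leading 1, then the tail. `inner` gives the strings while the middle block moves, `outer` those
-- after the leading bit has become 0. The middle block is the reverse complement of the current
-- string of `path u`, hence the exchange of levels in `innerV`.
inner : Dyck → Str → Str
inner v s = true ∷ (map not s ʳ++ (true ∷ word v))

outer : Dyck → Str → Str
outer u s = false ∷ (word u ʳ++ (true ∷ s))

innerV outerV : Dyck → Vertex → Vertex
innerV v (g , s) = not g , inner v s
outerV u (g , s) = g , outer u s

path : Dyck → List Vertex
path leaf       = (false , []) ∷ []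
path (node u v) = (false , word (node u v)) ∷ (map (innerV v) (path u) ++ map (outerV u) (path v))

ʳ++-++ : {A : Set} (xs ys zs : List A) → (xs ʳ++ ys) ++ zs ≡ xs ʳ++ (ys ++ zs)
ʳ++-++ []       ys zs = refl
ʳ++-++ (x ∷ xs) ys zs = ʳ++-++ xs (x ∷ ys) zs

map-not-not : (s : Str) → map not (map not s) ≡ s
map-not-not []      = refl
map-not-not (b ∷ s) = cong₂ _∷_ (not-involutive b) (map-not-not s)

reverse-ʳ++ : {A : Set} (xs ys : List A) → reverse (xs ʳ++ ys) ≡ ys ʳ++ xs
reverse-ʳ++ xs ys = trans (ʳ++-ʳ++ xs) (cong (ys ʳ++_) (++-identityʳ xs))

word-ʳ++ : ∀ u v r → word (node u v) ʳ++ r ≡ word v ʳ++ (false ∷ map not (word u) ++ true ∷ r)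
word-ʳ++ u v r = ʳ++-ʳ++ (map not (word u))

not-word : ∀ u v → map not (word (node u v)) ≡ false ∷ (word u ʳ++ (true ∷ map not (word v)))
not-word u v = cong (false ∷_) (trans (map-ʳ++ not (map not (word u))) (cong (_ʳ++ (true ∷ map not (word v))) (map-not-not (word u))))

-- Unique readability: reading 0 as an opening and 1 as a closing bracket, cut
-- returns what follows the first unmatched closing bracket.

cut : ℕ → Str → Maybe Str
cut h       []          = nothing
cut h       (false ∷ s) = cut (suc h) s
cut zero    (true ∷ s)  = just s
cut (suc h) (true ∷ s)  = cut h s

-- A Dyck word reversed, and likewise a Dyck word complemented, is balanced when 0 is the opening
-- bracket, so `cut` passes over it at every height. The mirrored left subtree makes the two
-- inductions call each other.
cut-rev : ∀ x h r → cut h (word x ʳ++ r) ≡ cut h r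
cut-not : ∀ x h r → cut h (map not (word x) ++ r) ≡ cut h r
cut-rev leaf       h r = refl
cut-rev (node u v) h r = trans (cong (cut h) (word-ʳ++ u v r)) (trans (cut-rev v h _) (cut-not u (suc h) (true ∷ r)))
cut-not leaf       h r = refl
cut-not (node u v) h r = trans (cong (λ l → cut h (l ++ r)) (not-word u v))
  (trans (cong (cut (suc h)) (ʳ++-++ (word u) _ r)) (trans (cut-rev u (suc h) _) (cut-not v h r)))

ʳ++-injectiveˡ : {A : Set} (xs ys zs : List A) → xs ʳ++ zs ≡ ys ʳ++ zs → xs ≡ ys
ʳ++-injectiveˡ xs ys zs eq = reverse-injective (++-cancelʳ zs (reverse xs) (reverse ys) (trans (sym (ʳ++-defn xs)) (trans eq (ʳ++-defn ys))))

-- The first unmatched 1 is the one right after the reversed Dyck word, so `cut 0` recovers the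
-- rest; cancelling this common suffix leaves the word.
cut-stop : ∀ {u u' s s'} → word u ʳ++ (true ∷ s) ≡ word u' ʳ++ (true ∷ s') → s ≡ s' × word u ≡ word u'
cut-stop {u} {u'} {s} {s'} eq = s≡s' , ʳ++-injectiveˡ _ _ _ (trans eq (cong (λ z → word u' ʳ++ (true ∷ z)) (sym s≡s')))
  where
  s≡s' : s ≡ s'
  s≡s' = just-injective (trans (sym (cut-rev u 0 (true ∷ s))) (trans (cong (cut 0) eq) (cut-rev u' 0 (true ∷ s'))))

word-injective : ∀ x y → word x ≡ word y → x ≡ y
word-injective leaf       leaf         eq = refl
word-injective (node u v) (node u' v') eq
  with cut-stop {u} {u'} (∷-injectiveʳ (trans (sym (not-word u v)) (trans (cong (map not) eq) (not-word u' v'))))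
... | v≡ , u≡ = cong₂ node (word-injective u u' u≡) (word-injective v v' (map-injective not-injective v≡))

outer-injective : ∀ {u u' s s'} → outer u s ≡ outer u' s' → u ≡ u' × s ≡ s'
outer-injective {u} {u'} eq with cut-stop {u} {u'} (∷-injectiveʳ eq)
... | s≡ , u≡ = word-injective u u' u≡ , s≡

inner-rev : ∀ v s → reverse (map not s ʳ++ (true ∷ word v)) ≡ word v ʳ++ (true ∷ map not s)
inner-rev v s = reverse-ʳ++ (map not s) (true ∷ word v)

inner-injective : ∀ {v v' s s'} → inner v s ≡ inner v' s' → v ≡ v' × s ≡ s'
inner-injective {v} {v'} {s} {s'} eq
  with cut-stop {v} {v'} (trans (sym (inner-rev v s)) (trans (cong reverse (∷-injectiveʳ eq)) (inner-rev v' s')))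
... | s≡ , v≡ = word-injective v v' v≡ , map-injective not-injective s≡

just≢nothing : {A : Set} {a : A} → just a ≢ nothing
just≢nothing ()

-- Without the first letter and read backwards, `inner v s` has an unmatched 1, whereas a Dyck word
-- has none.
word≢inner : ∀ x v s → word x ≢ inner v s
word≢inner (node u v) v' s eq = just≢nothing (trans (sym stops) (trans (cong (cut 0) same) runs))
  where
  same : word v' ʳ++ (true ∷ map not s) ≡ word v ʳ++ (false ∷ map not (word u))
  same = trans (sym (inner-rev v' s)) (trans (cong reverse (sym (∷-injectiveʳ eq))) (reverse-ʳ++ (map not (word u)) (false ∷ word v)))
  stops : cut 0 (word v' ʳ++ (true ∷ map not s)) ≡ just (map not s)
  stops = cut-rev v' 0 _
  runs : cut 0 (word v ʳ++ (false ∷ map not (word u))) ≡ nothing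
  runs = trans (cut-rev v 0 _) (trans (cong (cut 1) (sym (++-identityʳ (map not (word u))))) (cut-not u 1 []))

-- The paths are simple and pairwise disjoint.

data OnPath (u v : Dyck) : Vertex → Set where
  start  : OnPath u v (false , word (node u v))
  inside : ∀ {p} → p ∈ path u → OnPath u v (innerV v p)
  after  : ∀ {p} → p ∈ path v → OnPath u v (outerV u p)

onPath : ∀ u v {p} → p ∈ path (node u v) → OnPath u v p
onPath u v (here refl) = start
onPath u v (there p∈) with ∈-++⁻ (map (innerV v) (path u)) p∈
... | inj₁ i with ∈-map⁻ (innerV v) i
...   | _ , q , refl = inside q
onPath u v (there p∈) | inj₂ i with ∈-map⁻ (outerV u) i
...   | _ , q , refl = after q

inside∈ : ∀ u v {p} → p ∈ path u → innerV v p ∈ path (node u v)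
inside∈ u v p∈ = there (∈-++⁺ˡ (∈-map⁺ (innerV v) p∈))

after∈ : ∀ u v {p} → p ∈ path v → outerV u p ∈ path (node u v)
after∈ u v p∈ = there (∈-++⁺ʳ (map (innerV v) (path u)) (∈-map⁺ (outerV u) p∈))

word∈path : ∀ x → (false , word x) ∈ path x
word∈path leaf       = here refl
word∈path (node u v) = here refl

innerV-injective : ∀ {v v' p p'} → innerV v p ≡ innerV v' p' → v ≡ v' × p ≡ p'
innerV-injective {v} {v'} {g , s} {g' , s'} eq with inner-injective {v} {v'} {s} {s'} (cong proj₂ eq)
... | v≡ , s≡ = v≡ , cong₂ _,_ (not-injective (cong proj₁ eq)) s≡

outerV-injective : ∀ {u u' p p'} → outerV u p ≡ outerV u' p' → u ≡ u' × p ≡ p'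
outerV-injective {u} {u'} {g , s} {g' , s'} eq with outer-injective {u} {u'} {s} {s'} (cong proj₂ eq)
... | u≡ , s≡ = u≡ , cong₂ _,_ (cong proj₁ eq) s≡

node∌[] : ∀ {u v p} → OnPath u v p → proj₂ p ≢ []
node∌[] start      ()
node∌[] (inside _) ()
node∌[] (after _)  ()

-- A first bit 0 singles out the stretch `after`, and `word≢inner` tells `start` from `inside`.
-- Within one stretch, injectivity of `innerV` or `outerV` passes to a subtree.
path-disjoint : ∀ x y {p} → p ∈ path x → p ∈ path y → x ≡ y
path-disjoint leaf leaf _ _ = refl
path-disjoint leaf (node u v) (here refl) q = ⊥-elim (node∌[] (onPath u v q) refl)
path-disjoint (node u v) leaf p (here refl) = ⊥-elim (node∌[] (onPath u v p) refl)
path-disjoint (node u v) (node u' v') p∈ q∈ = go (onPath u v p∈) (onPath u' v' q∈) refl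
  where
  go : ∀ {p q} → OnPath u v p → OnPath u' v' q → p ≡ q → node u v ≡ node u' v'
  go start start eq = word-injective (node u v) (node u' v') (cong proj₂ eq)
  go start (inside {_ , s} q) eq = ⊥-elim (word≢inner (node u v) v' s (cong proj₂ eq))
  go (inside {_ , s} p) start eq = ⊥-elim (word≢inner (node u' v') v s (sym (cong proj₂ eq)))
  go (inside {p₁} p) (inside {p₂} q) eq with innerV-injective {v} {v'} {p₁} {p₂} eq
  ... | refl , refl = cong (λ z → node z v) (path-disjoint u u' p q)
  go (after {p₁} p) (after {p₂} q) eq with outerV-injective {u} {u'} {p₁} {p₂} eq
  ... | refl , refl = cong (node u) (path-disjoint v v' p q)
  go start (after q) ()
  go (inside p) (after q) ()
  go (after p) start ()
  go (after p) (inside q) ()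

path-unique : ∀ x → Unique (path x)
path-unique leaf       = [] ∷ []
path-unique (node u v) = All.tabulate fresh ∷
  Unique.++⁺ (Unique.map⁺ (λ {p} {q} eq → proj₂ (innerV-injective {v} {v} {p} {q} eq)) (path-unique u))
             (Unique.map⁺ (λ {p} {q} eq → proj₂ (outerV-injective {u} {u} {p} {q} eq)) (path-unique v)) apart
  where
  apart : ∀ {p} → ¬ (p ∈ map (innerV v) (path u) × p ∈ map (outerV u) (path v))
  apart (i , j) with ∈-map⁻ (innerV v) i | ∈-map⁻ (outerV u) j
  ... | _ , _ , refl | _ , _ , ()
  fresh : ∀ {p} → p ∈ map (innerV v) (path u) ++ map (outerV u) (path v) → (false , word (node u v)) ≢ p
  fresh p∈ refl with ∈-++⁻ (map (innerV v) (path u)) p∈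
  ... | inj₁ i with ∈-map⁻ (innerV v) i
  ...   | (_ , s) , _ , eq = word≢inner (node u v) v s (cong proj₂ eq)
  fresh p∈ refl | inj₂ j with ∈-map⁻ (outerV u) j
  ...   | _ , _ , ()

-- Weights

ones zeros : Str → ℕ
ones []          = 0
ones (true ∷ s)  = suc (ones s)
ones (false ∷ s) = ones s
zeros []          = 0
zeros (true ∷ s)  = zeros s
zeros (false ∷ s) = suc (zeros s)

ones-not : ∀ s → ones (map not s) ≡ zeros s
ones-not []          = refl
ones-not (true ∷ s)  = ones-not s
ones-not (false ∷ s) = cong suc (ones-not s)

zeros-not : ∀ s → zeros (map not s) ≡ ones s
zeros-not []          = refl
zeros-not (true ∷ s)  = cong suc (zeros-not s)
zeros-not (false ∷ s) = zeros-not s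

ones-ʳ++ : ∀ s r → ones (s ʳ++ r) ≡ ones s + ones r
ones-ʳ++ []          r = refl
ones-ʳ++ (true ∷ s)  r = trans (ones-ʳ++ s (true ∷ r)) (+-suc (ones s) (ones r))
ones-ʳ++ (false ∷ s) r = ones-ʳ++ s (false ∷ r)

zeros-ʳ++ : ∀ s r → zeros (s ʳ++ r) ≡ zeros s + zeros r
zeros-ʳ++ []          r = refl
zeros-ʳ++ (false ∷ s) r = trans (zeros-ʳ++ s (false ∷ r)) (+-suc (zeros s) (zeros r))
zeros-ʳ++ (true ∷ s)  r = zeros-ʳ++ s (true ∷ r)

length-split : ∀ s → length s ≡ ones s + zeros s
length-split []          = refl
length-split (true ∷ s)  = cong suc (length-split s)
length-split (false ∷ s) = trans (cong suc (length-split s)) (sym (+-suc (ones s) (zeros s)))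

ones-word : ∀ x → ones (word x) ≡ size x
zeros-word : ∀ x → zeros (word x) ≡ size x
ones-word leaf       = refl
ones-word (node u v) = cong suc (trans (ones-ʳ++ (map not (word u)) _) (cong₂ _+_ (trans (ones-not (word u)) (zeros-word u)) (ones-word v)))
zeros-word leaf       = refl
zeros-word (node u v) = trans (zeros-ʳ++ (map not (word u)) _) (trans (cong₂ _+_ (trans (zeros-not (word u)) (ones-word u)) (cong suc (zeros-word v))) (+-suc (size u) (size v)))

excess : Bool → ℕ
excess false = 0
excess true  = 1

path-weight : ∀ x {g s} → (g , s) ∈ path x → ones s ≡ excess g + size x × excess g + zeros s ≡ size x
path-weight leaf (here refl) = refl , refl
path-weight (node u v) p∈ = go (onPath u v p∈)
  where
  open +-*-Solver
  go : ∀ {p} → OnPath u v p → ones (proj₂ p) ≡ excess (proj₁ p) + size (node u v) × excess (proj₁ p) + zeros (proj₂ p) ≡ size (node u v)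
  go start = ones-word (node u v) , zeros-word (node u v)
  go (inside {false , s} q) with path-weight u q
  ... | o , z = cong suc (trans (ones-ʳ++ (map not s) _) (trans (cong₂ _+_ (trans (ones-not s) z) (cong suc (ones-word v))) (+-suc _ _)))
              , cong suc (trans (zeros-ʳ++ (map not s) _) (cong₂ _+_ (trans (zeros-not s) o) (zeros-word v)))
  go (inside {true , s} q) with path-weight u q
  ... | o , z = cong suc (trans (ones-ʳ++ (map not s) _) (trans (cong₂ _+_ (ones-not s) (cong suc (ones-word v))) (trans (+-suc _ _) (cong (_+ size v) z))))
              , trans (zeros-ʳ++ (map not s) _) (cong₂ _+_ (trans (zeros-not s) o) (zeros-word v))
  go (after {g , s} q) with path-weight v q
  ... | o , z = trans (ones-ʳ++ (word u) (true ∷ s)) (trans (cong₂ _+_ (ones-word u) (cong suc o))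
                  (solve 3 (λ a b c → a :+ (con 1 :+ (b :+ c)) := b :+ (con 1 :+ (a :+ c))) refl (size u) (excess g) (size v)))
              , trans (cong (λ z → excess g + suc z) (trans (zeros-ʳ++ (word u) (true ∷ s)) (cong (_+ zeros s) (zeros-word u))))
                  (trans (solve 3 (λ a b c → b :+ (con 1 :+ (a :+ c)) := con 1 :+ (a :+ (b :+ c))) refl (size u) (excess g) (zeros s))
                         (cong (λ z → suc (size u + z)) z))

-- Every vertex lies on a path

data Bal : Str → Set where
  []   : Bal []
  wrap : ∀ {l m} → Bal l → Bal m → Bal (false ∷ l ++ true ∷ m)

-- In `bal-rev` the word `v` is an accumulator: it holds the blocks already read, and each further
-- block of `l` becomes the left subtree of a new root above it.
bal-not : ∀ {l} → Bal l → ∃ λ x → l ≡ map not (word x)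
bal-rev : ∀ {l} → Bal l → ∀ v → ∃ λ x → ∀ r → word v ʳ++ (l ++ r) ≡ word x ʳ++ r
bal-not [] = leaf , refl
bal-not (wrap {l} {m} L M) with bal-rev L leaf | bal-not M
... | u , l≡ | v , m≡ = node u v , trans (cong (false ∷_) (trans (l≡ (true ∷ m)) (cong (λ z → word u ʳ++ (true ∷ z)) m≡))) (sym (not-word u v))
bal-rev [] v = v , λ r → refl
bal-rev (wrap {l} {m} L M) v with bal-not L
... | u , refl with bal-rev M (node u v)
...   | x , eq = x , λ r → trans (cong (λ z → word v ʳ++ (false ∷ z)) (++-assoc l (true ∷ m) r)) (trans (sym (word-ʳ++ u v (m ++ r))) (eq r))

data Opens : ℕ → Str → Set where
  done : ∀ {l} → Bal l → Opens 0 l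
  more : ∀ {q l m} → Bal l → Opens q m → Opens (suc q) (l ++ false ∷ m)

-- Parsed p q s: s has p unmatched closing and q unmatched opening brackets.
data Parsed : ℕ → ℕ → Str → Set where
  opens  : ∀ {q s} → Opens q s → Parsed 0 q s
  closes : ∀ {p q l s} → Bal l → Parsed p q s → Parsed (suc p) q (l ++ true ∷ s)

wrap-++ : ∀ {l m} (P : Str → Set) (r : Str) → P ((false ∷ l ++ true ∷ m) ++ r) → P (false ∷ l ++ true ∷ m ++ r)
wrap-++ {l} {m} P r = subst P (cong (false ∷_) (++-assoc l (true ∷ m) r))

-- The new 0 is matched with the 1 after `l`, and the wrapped block then joins the balanced block at
-- the front of the rest.
absorb : ∀ {p q l s} → Bal l → Parsed p q s → Parsed p q (false ∷ l ++ true ∷ s)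
absorb L (opens (done M))              = opens (done (wrap L M))
absorb L (opens (more {l = m} M r))    = wrap-++ (Parsed _ _) (false ∷ _) (opens (more (wrap L M) r))
absorb L (closes {l = m} M r)          = wrap-++ (Parsed _ _) (true ∷ _) (closes (wrap L M) r)

parse : ∀ s → ∃ λ p → ∃ λ q → Parsed p q s
parse [] = 0 , 0 , opens (done [])
parse (true ∷ s) with parse s
... | p , q , d = suc p , q , closes [] d
parse (false ∷ s) with parse s
... | .0 , q , opens o             = 0 , suc q , opens (more [] o)
... | .(suc _) , q , closes L d    = _ , q , absorb L d

ones-++ : ∀ s r → ones (s ++ r) ≡ ones s + ones r
ones-++ []          r = refl
ones-++ (true ∷ s)  r = cong suc (ones-++ s r)
ones-++ (false ∷ s) r = ones-++ s r

zeros-++ : ∀ s r → zeros (s ++ r) ≡ zeros s + zeros r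
zeros-++ []          r = refl
zeros-++ (true ∷ s)  r = zeros-++ s r
zeros-++ (false ∷ s) r = cong suc (zeros-++ s r)

bal-weight : ∀ {l} → Bal l → ones l ≡ zeros l
bal-weight L with bal-not L
... | x , refl = trans (ones-not (word x)) (trans (zeros-word x) (sym (trans (zeros-not (word x)) (ones-word x))))

opens-weight : ∀ {q s} → Opens q s → ones s + q ≡ zeros s
opens-weight (done {l} L) = trans (+-comm (ones l) 0) (bal-weight L)
opens-weight (more {q} {l} {m} L o) rewrite ones-++ l (false ∷ m) | zeros-++ l (false ∷ m) | bal-weight L =
  trans (+-assoc (zeros l) (ones m) (suc q)) (cong (zeros l +_) (trans (+-suc (ones m) q) (cong suc (opens-weight o))))

-- In a string of length 2k this means weight k on the lower level and k+1 on the upper one.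
Level : Vertex → Set
Level (g , s) = ones s ≡ excess g + (excess g + zeros s)

-- At either level the ones are at least as many as the zeros, so after a leading 0 the rest has a
-- surplus of ones and hence an unmatched 1.
closed-first : ∀ {p q g s} → Parsed p q s → Level (g , false ∷ s) → ∃ λ l → ∃ λ r → Bal l × s ≡ l ++ true ∷ r
closed-first (closes L d) _ = _ , _ , L , refl
closed-first {g = g} (opens {q} {s} o) lev = ⊥-elim (absurd (excess g) (zeros s) q
    (trans (cong (_+ q) (sym lev)) (opens-weight o)))
  where
  open +-*-Solver
  absurd : ∀ e z q → e + (e + suc z) + q ≢ z
  absurd e z q eq = contra (+-cancelˡ-≡ z (suc (e + e + q)) 0 (trans (trans (solve 3 (λ e z q → z :+ (con 1 :+ (e :+ e :+ q)) := e :+ (e :+ (con 1 :+ z)) :+ q) refl e z q) eq) (+-comm 0 z)))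
    where contra : ∀ {n} → suc n ≢ 0
          contra ()

-- This inverts the decomposition in `path`: the first bit and the first unmatched bracket tell on
-- which stretch the string lies. The bound `n` carries the recursion, whose argument may be a
-- complemented remainder.
covered : ∀ n g s → length s ≤ n → Level (g , s) → ∃ λ x → (g , s) ∈ path x
covered n false []        _ _ = leaf , here refl
covered n true  []        _ ()
-- A leading 0 means that the leading 1 has been flipped; `l`, up to the first unmatched 1, is the
-- reversed word of `u`.
covered (suc n) g (false ∷ s) (s≤s s≤n) lev with parse s
... | _ , _ , d with closed-first {g = g} d lev
...   | l , r , L , refl with bal-rev L leaf
...     | u , l≡ with covered n g r (≤-trans (≤-trans (≤-trans (n≤1+n _) (m≤n+m _ (length l))) (≤-reflexive (sym (length-++ l)))) s≤n) lev'
  where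
  open +-*-Solver
  lev' : Level (g , r)
  lev' = +-cancelˡ-≡ (suc (zeros l)) _ _ (trans (trans (trans (sym (+-suc (zeros l) (ones r))) (cong (_+ suc (ones r)) (sym (bal-weight L)))) (trans (sym (ones-++ l (true ∷ r))) lev))
    (trans (cong (λ z → excess g + (excess g + suc z)) (zeros-++ l (true ∷ r)))
      (solve 3 (λ e z y → e :+ (e :+ (con 1 :+ (z :+ y))) := con 1 :+ z :+ (e :+ (e :+ y))) refl (excess g) (zeros l) (zeros r))))
...       | v , r∈ = node u v , subst (λ z → (g , false ∷ z) ∈ path (node u v)) (sym (l≡ (true ∷ r))) (after∈ u v r∈)
-- After a leading 1 the remainder is read backwards: an unmatched 1 places the string on the copy
-- of `path u`, and without one the string must be the Dyck word itself.
covered (suc n) g (true ∷ s) (s≤s s≤n) lev = subst (λ z → ∃ λ x → (g , true ∷ z) ∈ path x) (reverse-involutive s)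
    (go (proj₂ (proj₂ (parse (reverse s)))) (≤-trans (≤-reflexive (trans (length-ʳ++ s) (+-comm (length s) 0))) s≤n) lev-rev)
  where
  open +-*-Solver
  lev-rev : suc (ones (reverse s)) ≡ excess g + (excess g + zeros (reverse s))
  lev-rev = trans (cong suc (trans (ones-ʳ++ s []) (+-comm _ 0))) (trans lev (cong (λ z → excess g + (excess g + z)) (sym (trans (zeros-ʳ++ s []) (+-comm _ 0)))))
  flip-level : ∀ g r → suc (suc (ones r)) ≡ excess g + (excess g + zeros r) → Level (not g , map not r)
  flip-level false r eq = trans (ones-not r) (trans (sym eq) (cong (λ z → suc (suc z)) (sym (zeros-not r))))
  flip-level true r eq = trans (ones-not r) (trans (sym (suc-injective (suc-injective eq))) (sym (zeros-not r)))
  go : ∀ {p q t} → Parsed p q t → length t ≤ n → suc (ones t) ≡ excess g + (excess g + zeros t) → ∃ λ x → (g , true ∷ reverse t) ∈ path x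
  go (closes {l = l} {s = r} L d) t≤n eq with bal-rev L leaf
  ... | v , l≡ with covered n (not g) (map not r) (≤-trans (≤-trans (≤-trans (≤-trans (≤-reflexive (length-map not r)) (n≤1+n _)) (m≤n+m _ (length l))) (≤-reflexive (sym (length-++ l)))) t≤n)
                     (flip-level g r (+-cancelˡ-≡ (zeros l) _ _ (trans (trans (trans (+-suc (zeros l) (suc (ones r))) (cong (λ z → suc (z + suc (ones r))) (sym (bal-weight L))))
                       (trans (cong suc (sym (ones-++ l (true ∷ r)))) eq))
                         (trans (cong (λ z → excess g + (excess g + z)) (zeros-++ l (true ∷ r)))
                           (solve 3 (λ e z y → e :+ (e :+ (z :+ y)) := z :+ (e :+ (e :+ y))) refl (excess g) (zeros l) (zeros r))))))
  ...   | u , r∈ = node u v , subst (_∈ path (node u v)) same (inside∈ u v r∈)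
    where
    same : innerV v (not g , map not r) ≡ (g , true ∷ reverse (l ++ true ∷ r))
    same = cong₂ _,_ (not-involutive g) (cong (true ∷_) (trans (cong (_ʳ++ (true ∷ word v)) (map-not-not r))
             (sym (trans (cong reverse (l≡ (true ∷ r))) (reverse-ʳ++ (word v) (true ∷ r))))))
  go (opens (done {l} L)) t≤n eq = ⊥-elim (odd (excess g) (zeros l) (trans (cong suc (sym (bal-weight L))) eq))
    where
    odd : ∀ e z → suc z ≢ e + (e + z)
    odd zero    z       eq = contra z eq where
      contra : ∀ z → suc z ≢ z
      contra (suc z) eq = contra z (suc-injective eq)
    odd (suc e) z eq = contra (e + e) (+-cancelˡ-≡ z 0 (suc (e + e)) (trans (+-comm z 0) (trans (suc-injective eq) (solve 2 (λ e z → e :+ (con 1 :+ (e :+ z)) := z :+ (con 1 :+ (e :+ e))) refl e z)))) where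
      contra : ∀ z → 0 ≢ suc z
      contra z ()
  -- No unmatched 1 and at least one unmatched 0: the weights leave only the lower level and exactly
  -- one such 0, the separating 0 of `node u v`.
  go (opens (more {q} {l} {m} L o)) t≤n eq = last o eq
    where
    last : ∀ {q m} → Opens q m → suc (ones (l ++ false ∷ m)) ≡ excess g + (excess g + zeros (l ++ false ∷ m)) → ∃ λ x → (g , true ∷ reverse (l ++ false ∷ m)) ∈ path x
    last {q} {m} o eq = conclude g o (+-cancelˡ-≡ (zeros l + ones m) 0 _ (suc-injective (trans
        (trans (solve 2 (λ z y → con 1 :+ (z :+ y :+ con 0) := con 1 :+ (z :+ y)) refl (zeros l) (ones m)) (cong (λ z → suc (z + ones m)) (sym (bal-weight L))))
        (trans (cong suc (sym (ones-++ l (false ∷ m)))) (trans eq (trans (cong (λ z → excess g + (excess g + z)) (trans (zeros-++ l (false ∷ m)) (cong (λ z → zeros l + suc z) (sym (opens-weight o)))))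
          (solve 4 (λ e z y q → e :+ (e :+ (z :+ (con 1 :+ (y :+ q)))) := con 1 :+ ((z :+ y) :+ (e :+ e :+ q))) refl (excess g) (zeros l) (ones m) q)))))))
      where
      conclude : ∀ g → Opens q m → 0 ≡ excess g + excess g + q → ∃ λ x → (g , true ∷ reverse (l ++ false ∷ m)) ∈ path x
      conclude false (done M) _ with bal-rev L leaf | bal-not M
      ... | v , l≡ | u , m≡ = node u v , here (cong (λ z → false , true ∷ z)
              (trans (cong reverse (trans (l≡ (false ∷ m)) (cong (λ z → word v ʳ++ (false ∷ z)) m≡))) (reverse-ʳ++ (word v) (false ∷ map not (word u)))))
      conclude false (more _ _) ()
      conclude true _ ()

-- Walks

module _ {A : Set} where

  -- Adjacency is no part of a walk: it fixes the two ends of a nonempty list, and `Step` names the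
  -- consecutive pairs.
  data Walk : A → A → List A → Set where
    stop : ∀ {a} → Walk a a (a ∷ [])
    go   : ∀ a {b c p} → Walk b c p → Walk a c (a ∷ p)

  data Step : List A → A → A → Set where
    here  : ∀ {x y p} → Step (x ∷ y ∷ p) x y
    there : ∀ {x y z p} → Step p x y → Step (z ∷ p) x y

  Edge : List A → A → A → Set
  Edge p x y = Step p x y ⊎ Step p y x

  private variable
    a b c d x y : A
    p q : List A

  walk-++ : Walk a b p → Walk c d q → Walk a d (p ++ q)
  walk-++ stop     w = go _ w
  walk-++ (go a v) w = go a (walk-++ v w)

  first∈ : Walk a b p → a ∈ p
  first∈ stop     = here refl
  first∈ (go _ _) = here refl

  last∈ : Walk a b p → b ∈ p
  last∈ stop     = here refl
  last∈ (go _ w) = there (last∈ w)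

  step-∈ˡ : Step p x y → x ∈ p
  step-∈ˡ here      = here refl
  step-∈ˡ (there s) = there (step-∈ˡ s)

  step-∈ʳ : Step p x y → y ∈ p
  step-∈ʳ here      = there (here refl)
  step-∈ʳ (there s) = there (step-∈ʳ s)

  step-++ˡ : Step p x y → Step (p ++ q) x y
  step-++ˡ here      = here
  step-++ˡ (there s) = there (step-++ˡ s)

  step-++ʳ : ∀ p → Step q x y → Step (p ++ q) x y
  step-++ʳ []      s = s
  step-++ʳ (z ∷ p) s = there (step-++ʳ p s)

  step-join : Walk a b p → Walk c d q → Step (p ++ q) b c
  step-join stop     stop     = here
  step-join stop     (go _ _) = here
  step-join (go _ v) w        = there (step-join v w)

  step-++⁻ : Walk a b p → Walk c d q → Step (p ++ q) x y → Step p x y ⊎ (x ≡ b × y ≡ c) ⊎ Step q x y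
  step-++⁻ stop stop     here          = inj₂ (inj₁ (refl , refl))
  step-++⁻ stop (go _ w) here          = inj₂ (inj₁ (refl , refl))
  step-++⁻ stop w        (there s)     = inj₂ (inj₂ s)
  step-++⁻ (go _ stop) w here          = inj₁ here
  step-++⁻ (go _ (go _ _)) w here      = inj₁ here
  step-++⁻ (go _ v) w (there s)        = Sum.map₁ there (step-++⁻ v w s)

  walk-reverse : Walk a b p → Walk b a (reverse p)
  walk-reverse stop = stop
  walk-reverse (go a {p = p} w) = subst (Walk _ _) (sym (unfold-reverse a p)) (walk-++ (walk-reverse w) stop)

  step-reverse : Walk a b p → Step p x y → Step (reverse p) y x
  step-reverse (go a {p = p} stop) here = here
  step-reverse (go a {p = p} (go c w)) here = subst (λ l → Step l _ _) (sym (unfold-reverse a p)) (step-join (walk-reverse (go c w)) stop)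
  step-reverse (go a {p = p} w) (there s) = subst (λ l → Step l _ _) (sym (unfold-reverse a p)) (step-++ˡ (step-reverse w s))

  step-reverse⁻ : Walk a b p → Step (reverse p) x y → Step p y x
  step-reverse⁻ {p = p} w s = subst (λ l → Step l _ _) (reverse-involutive p) (step-reverse (walk-reverse w) s)

  unique-reverse : Unique p → Unique (reverse p)
  unique-reverse [] = []
  unique-reverse {p = z ∷ p} (z∉ ∷ u) = subst Unique (sym (unfold-reverse z p))
    (Unique.++⁺ (unique-reverse u) ([] ∷ []) λ { (i , here refl) → All.lookup z∉ (Any.reverse⁻ i) refl })

  step-split : Walk a b p → Step p x y → ∃ λ p₁ → ∃ λ p₂ → p ≡ p₁ ++ p₂ × Walk a x p₁ × Walk y b p₂
  step-split (go a stop)     here = _ , _ , refl , stop , stop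
  step-split (go a (go c w)) here = _ , _ , refl , stop , go c w
  step-split (go a w) (there s) with step-split w s
  ... | p₁ , p₂ , refl , w₁ , w₂ = a ∷ p₁ , p₂ , refl , go a w₁ , w₂

  Cyclic : A → A → List A → A → A → Set
  Cyclic a b p x y = Edge p x y ⊎ ((x ≡ b × y ≡ a) ⊎ (x ≡ a × y ≡ b))

  Same : A → A → A → A → Set
  Same c d x y = (x ≡ c × y ≡ d) ⊎ (x ≡ d × y ≡ c)

  -- The cycle that closes `p`, cut at the edge `c d` and run through from `c` to `d`. That `c d` no
  -- longer occurs in `list` is obtained separately from `no-chord`.
  record Opened (a b : A) (p : List A) (c d : A) : Set where
    field
      list   : List A
      walk   : Walk c d list
      simple : Unique list
      ∈⇒     : ∀ {x} → x ∈ list → x ∈ p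
      ∈⇐     : ∀ {x} → x ∈ p → x ∈ list
      edge⇒  : ∀ {x y} → Edge list x y → Cyclic a b p x y
      edge⇐  : ∀ {x y} → Cyclic a b p x y → Edge list x y ⊎ Same c d x y

  flip-opened : Opened a b p c d → Opened a b p d c
  flip-opened o = record
    { list   = reverse list
    ; walk   = walk-reverse walk
    ; simple = unique-reverse simple
    ; ∈⇒     = λ i → ∈⇒ (Any.reverse⁻ i)
    ; ∈⇐     = λ i → Any.reverse⁺ (∈⇐ i)
    ; edge⇒  = λ e → edge⇒ (Sum.swap (Sum.map (step-reverse⁻ walk) (step-reverse⁻ walk) e))
    ; edge⇐  = λ e → Sum.map (λ f → Sum.swap (Sum.map (step-reverse walk) (step-reverse walk) f)) Sum.swap (edge⇐ e)
    } where open Opened o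

  open-closing : Walk a b p → Unique p → Opened a b p a b
  open-closing w u = record
    { list = _ ; walk = w ; simple = u ; ∈⇒ = λ i → i ; ∈⇐ = λ i → i ; edge⇒ = inj₁ ; edge⇐ = Sum.map₂ Sum.swap }

  -- Swapping the two pieces on either side of the step turns the old closing edge into an interior
  -- step and the given step into the new closing edge.
  open-step : Walk a b p → Unique p → Step p x y → Opened a b p y x
  open-step {a} {b} {x = c} {y = d} w u s with step-split w s
  ... | p₁ , p₂ , refl , w₁ , w₂ = record
    { list   = p₂ ++ p₁
    ; walk   = walk-++ w₂ w₁
    ; simple = Unique.++⁺ (proj₁ (proj₂ (uniq-++⁻ p₁ u))) (proj₁ (uniq-++⁻ p₁ u)) (λ { (i , j) → proj₂ (proj₂ (uniq-++⁻ p₁ u)) j i })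
    ; ∈⇒     = λ i → swap∈ p₂ i
    ; ∈⇐     = λ i → swap∈ p₁ i
    ; edge⇒  = λ { (inj₁ t) → fwd t ; (inj₂ t) → symm (fwd t) }
    ; edge⇐  = λ { (inj₁ (inj₁ t)) → bwd t ; (inj₁ (inj₂ t)) → Sum.map Sum.swap same-sym (bwd t)
                 ; (inj₂ (inj₁ (refl , refl))) → inj₁ (inj₁ (step-join w₂ w₁))
                 ; (inj₂ (inj₂ (refl , refl))) → inj₁ (inj₂ (step-join w₂ w₁)) }
    }
    where
    uniq-++⁻ : ∀ r {s} → Unique (r ++ s) → Unique r × Unique s × (∀ {z} → z ∈ r → z ∈ s → ⊥)
    uniq-++⁻ []      u        = [] , u , λ ()
    uniq-++⁻ (z ∷ r) (z∉ ∷ u) with uniq-++⁻ r u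
    ... | ur , us , dis = All.tabulate (λ i → All.lookup z∉ (∈-++⁺ˡ i)) ∷ ur , us
        , λ { (here refl) j → All.lookup z∉ (∈-++⁺ʳ r j) refl ; (there i) j → dis i j }
    swap∈ : ∀ r {s z} → z ∈ r ++ s → z ∈ s ++ r
    swap∈ r {s} i = [ ∈-++⁺ʳ s , ∈-++⁺ˡ ]′ (∈-++⁻ r i)
    same-sym : ∀ {x y} → Same d c x y → Same d c y x
    same-sym (inj₁ (p , q)) = inj₂ (q , p)
    same-sym (inj₂ (p , q)) = inj₁ (q , p)
    symm : ∀ {x y} → Cyclic a b (p₁ ++ p₂) x y → Cyclic a b (p₁ ++ p₂) y x
    symm (inj₁ e)              = inj₁ (Sum.swap e)
    symm (inj₂ (inj₁ (p , q))) = inj₂ (inj₂ (q , p))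
    symm (inj₂ (inj₂ (p , q))) = inj₂ (inj₁ (q , p))
    fwd : ∀ {x y} → Step (p₂ ++ p₁) x y → Cyclic a b (p₁ ++ p₂) x y
    fwd t with step-++⁻ w₂ w₁ t
    ... | inj₁ r        = inj₁ (inj₁ (step-++ʳ p₁ r))
    ... | inj₂ (inj₁ r) = inj₂ (inj₁ r)
    ... | inj₂ (inj₂ r) = inj₁ (inj₁ (step-++ˡ r))
    bwd : ∀ {x y} → Step (p₁ ++ p₂) x y → Edge (p₂ ++ p₁) x y ⊎ Same d c x y
    bwd t with step-++⁻ w₁ w₂ t
    ... | inj₁ r        = inj₁ (inj₁ (step-++ʳ p₂ r))
    ... | inj₂ (inj₁ r) = inj₂ (inj₂ r)
    ... | inj₂ (inj₂ r) = inj₁ (inj₁ (step-++ˡ r))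

  open-cyclic : Walk a b p → Unique p → Cyclic a b p x y → Opened a b p x y
  open-cyclic w u (inj₁ (inj₁ s))             = flip-opened (open-step w u s)
  open-cyclic w u (inj₁ (inj₂ s))             = open-step w u s
  open-cyclic w u (inj₂ (inj₁ (refl , refl))) = flip-opened (open-closing w u)
  open-cyclic w u (inj₂ (inj₂ (refl , refl))) = open-closing w u

  -- If the ends of a simple walk were consecutive, they would be the whole walk; a third vertex
  -- excludes this. In this way a slot that is cut open is known to be gone.
  no-chord : ∀ {z} → Walk a b p → Unique p → z ∈ p → z ≢ a → z ≢ b → ¬ Edge p a b
  no-chord w (a∉ ∷ u) z∈ z≢a z≢b (inj₁ (there s)) = start∉ w a∉ (step-∈ˡ s)
    where
    start∉ : ∀ {a b q} → Walk a b (x ∷ q) → All (x ≢_) q → a ∉ q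
    start∉ stop      _  ()
    start∉ (go _ _) a∉ i = All.lookup a∉ i refl
  no-chord (go a stop) u (here refl) z≢a z≢b (inj₁ here) = z≢a refl
  no-chord (go a stop) u (there (here refl)) z≢a z≢b (inj₁ here) = z≢b refl
  no-chord (go a (go c w)) (_ ∷ (c∉ ∷ _)) z∈ z≢a z≢b (inj₁ here) = All.lookup c∉ (last∈ w) refl
  no-chord stop u z∈ z≢a z≢b (inj₂ (there ()))
  no-chord (go a w) (a∉ ∷ u) z∈ z≢a z≢b (inj₂ (there s)) = All.lookup a∉ (step-∈ʳ s) refl
  no-chord (go a w) (a∉ ∷ u) z∈ z≢a z≢b (inj₂ here) = All.lookup a∉ (here refl) refl

  edge-restrict : Walk a b p → Walk c d q → (∀ {z} → z ∈ p → z ∈ q → ⊥) → x ∈ p → y ∈ p → Edge (p ++ q) x y → Edge p x y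
  edge-restrict {p = p} {q = q} v w dis x∈ y∈ (inj₁ s) = inj₁ (step-restrict x∈ y∈ s)
    where
    step-restrict : ∀ {x y} → x ∈ p → y ∈ p → Step (p ++ q) x y → Step p x y
    step-restrict x∈ y∈ s with step-++⁻ v w s
    ... | inj₁ t                    = t
    ... | inj₂ (inj₁ (refl , refl)) = ⊥-elim (dis y∈ (first∈ w))
    ... | inj₂ (inj₂ t)             = ⊥-elim (dis x∈ (step-∈ˡ t))
  edge-restrict v w dis x∈ y∈ (inj₂ s) with edge-restrict v w dis y∈ x∈ (inj₁ s)
  ... | inj₁ t = inj₂ t
  ... | inj₂ t = inj₁ t

  edge-restrictʳ : Walk a b p → Walk c d q → (∀ {z} → z ∈ p → z ∈ q → ⊥) → x ∈ q → y ∈ q → Edge (p ++ q) x y → Edge q x y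
  edge-restrictʳ {p = p} {q = q} v w dis x∈ y∈ e = Sum.map (step-restrict x∈ y∈) (step-restrict y∈ x∈) e
    where
    step-restrict : ∀ {x y} → x ∈ q → y ∈ q → Step (p ++ q) x y → Step q x y
    step-restrict x∈ y∈ s with step-++⁻ v w s
    ... | inj₁ t                    = ⊥-elim (dis (step-∈ˡ t) x∈)
    ... | inj₂ (inj₁ (refl , refl)) = ⊥-elim (dis (last∈ v) x∈)
    ... | inj₂ (inj₂ t)             = t

-- Edges of the cube and the slots of a path.

data _⋖_ : Str → Str → Set where
  here  : ∀ {s} → (false ∷ s) ⋖ (true ∷ s)
  there : ∀ {c s t} → s ⋖ t → (c ∷ s) ⋖ (c ∷ t)

⋖-ʳ++ : ∀ l {s t} → s ⋖ t → (l ʳ++ s) ⋖ (l ʳ++ t)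
⋖-ʳ++ []      f = f
⋖-ʳ++ (c ∷ l) f = ⋖-ʳ++ l (there f)

not-⋖-ʳ++ : ∀ {s t} r → s ⋖ t → (map not t ʳ++ r) ⋖ (map not s ʳ++ r)
not-⋖-ʳ++ r (here {s})      = ⋖-ʳ++ (map not s) here
not-⋖-ʳ++ r (there {c} f)   = not-⋖-ʳ++ (not c ∷ r) f

inner-⋖ : ∀ v {s t} → s ⋖ t → inner v t ⋖ inner v s
inner-⋖ v f = there (not-⋖-ʳ++ (true ∷ word v) f)

outer-⋖ : ∀ u {s t} → s ⋖ t → outer u s ⋖ outer u t
outer-⋖ u f = there (⋖-ʳ++ (word u) (there f))

-- The edges of the path of node u v: the first edge, the edges of the copy of
-- the path of u, the edge leaving that copy, and the copy of the path of v.
data Slot : Dyck → Set where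
  enter leave : ∀ {u v} → Slot (node u v)
  inU : ∀ {u v} → Slot u → Slot (node u v)
  inV : ∀ {u v} → Slot v → Slot (node u v)

-- inner exchanges the two levels, hence lo and hi are exchanged under inU.
lo hi : ∀ {x} → Slot x → Str
lo {node u v} enter       = word (node u v)
lo {node u v} leave       = outer u (word v)
lo {node u v} (inU e) = inner v (hi e)
lo {node u v} (inV e) = outer u (lo e)
hi {node u v} enter       = inner v (word u)
hi {node u v} leave       = inner v (map not (word u))
hi {node u v} (inU e) = inner v (lo e)
hi {node u v} (inV e) = outer u (hi e)

low high : Str → Vertex
low  s = false , s
high s = true , s

last-inner : ∀ u v → inner v (map not (word u)) ≡ true ∷ (word u ʳ++ (true ∷ word v))
last-inner u v = cong (λ z → true ∷ (z ʳ++ (true ∷ word v))) (map-not-not (word u))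

slot-⋖ : ∀ {x} (e : Slot x) → lo e ⋖ hi e
slot-⋖ {node u v} enter       = there (⋖-ʳ++ (map not (word u)) here)
slot-⋖ {node u v} leave       = subst (outer u (word v) ⋖_) (sym (last-inner u v)) here
slot-⋖ {node u v} (inU e) = inner-⋖ v (slot-⋖ e)
slot-⋖ {node u v} (inV e) = outer-⋖ u (slot-⋖ e)

lastword∈ : ∀ x → low (map not (word x)) ∈ path x
lastword∈ leaf       = here refl
lastword∈ (node u v) = subst (λ z → low z ∈ path (node u v)) (sym (not-word u v)) (after∈ u v (lastword∈ v))

lo∈ : ∀ {x} (e : Slot x) → low (lo e) ∈ path x
hi∈ : ∀ {x} (e : Slot x) → high (hi e) ∈ path x
lo∈ {node u v} enter       = here refl
lo∈ {node u v} leave       = after∈ u v (word∈path v)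
lo∈ {node u v} (inU e) = inside∈ u v (hi∈ e)
lo∈ {node u v} (inV e) = after∈ u v (lo∈ e)
hi∈ {node u v} enter       = inside∈ u v (word∈path u)
hi∈ {node u v} leave       = inside∈ u v (lastword∈ u)
hi∈ {node u v} (inU e) = inside∈ u v (lo∈ e)
hi∈ {node u v} (inV e) = after∈ u v (hi∈ e)

-- The first bits of the ends and `word≢inner` separate the kinds of slot. Together with
-- `path-disjoint`, an edge thus determines both its word and its slot.
slot-injective : ∀ {x} (e f : Slot x) → lo e ≡ lo f → hi e ≡ hi f → e ≡ f
slot-injective {node u v} enter       enter       l h = refl
slot-injective {node u v} leave       leave       l h = refl
slot-injective {node u v} (inU e) (inU f) l h =
  cong inU (slot-injective e f (proj₂ (inner-injective {v} {v} h)) (proj₂ (inner-injective {v} {v} l)))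
slot-injective {node u v} (inV e) (inV f) l h =
  cong inV (slot-injective e f (proj₂ (outer-injective {u} {u} l)) (proj₂ (outer-injective {u} {u} h)))
slot-injective {node u v} enter       (inU f) l h = ⊥-elim (word≢inner (node u v) v (hi f) l)
slot-injective {node u v} (inU e) enter       l h = ⊥-elim (word≢inner (node u v) v (hi e) (sym l))
slot-injective {node u v} enter       leave       () h
slot-injective {node u v} enter       (inV f) () h
slot-injective {node u v} leave       enter       () h
slot-injective {node u v} leave       (inU f) () h
slot-injective {node u v} leave       (inV f) l ()
slot-injective {node u v} (inU e) leave       () h
slot-injective {node u v} (inU e) (inV f) () h
slot-injective {node u v} (inV e) enter       () h
slot-injective {node u v} (inV e) (inU f) () h
slot-injective {node u v} (inV e) leave       l ()

-- The third vertex that `no-chord` asks for when a cycle is cut at `e`.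
third : ∀ {x} (e : Slot x) → ∃ λ s → low s ∈ path x × s ≢ lo e
third {node u v} enter       = _ , lastword∈ (node u v) , λ ()
third {node u v} leave       = _ , word∈path (node u v) , λ ()
third {node u v} (inU e) = _ , lastword∈ (node u v) , λ ()
third {node u v} (inV e) = _ , word∈path (node u v) , λ ()

data Flip : Vertex → Vertex → Set where
  up   : ∀ {s t} → s ⋖ t → Flip (low s) (high t)
  down : ∀ {s t} → s ⋖ t → Flip (high t) (low s)

data Adj : Vertex → Vertex → Set where
  flips  : ∀ {p q} → Flip p q → Adj p q
  cross  : ∀ s → Adj (low s) (low (map not s))
  cross′ : ∀ s → Adj (low (map not s)) (low s)

flip-sym : ∀ {p q} → Flip p q → Flip q p
flip-sym (up f)   = down f
flip-sym (down f) = up f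

adj-sym : ∀ {p q} → Adj p q → Adj q p
adj-sym (flips f)  = flips (flip-sym f)
adj-sym (cross s)  = cross′ s
adj-sym (cross′ s) = cross s

innerV-flip : ∀ v {p q} → Flip p q → Flip (innerV v p) (innerV v q)
innerV-flip v (up f)   = down (inner-⋖ v f)
innerV-flip v (down f) = up (inner-⋖ v f)

outerV-flip : ∀ u {p q} → Flip p q → Flip (outerV u p) (outerV u q)
outerV-flip u (up f)   = up (outer-⋖ u f)
outerV-flip u (down f) = down (outer-⋖ u f)

module _ {A B : Set} (f : A → B) where

  walk-map : ∀ {x y p} → Walk x y p → Walk (f x) (f y) (map f p)
  walk-map stop     = stop
  walk-map (go x w) = go (f x) (walk-map w)

  step-map : ∀ {x y p} → Step p x y → Step (map f p) (f x) (f y)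
  step-map here      = here
  step-map (there s) = there (step-map s)

  step-map⁻ : ∀ {x y} p → Step (map f p) x y → ∃ λ x' → ∃ λ y' → Step p x' y' × x ≡ f x' × y ≡ f y'
  step-map⁻ (x ∷ y ∷ p) here = x , y , here , refl , refl
  step-map⁻ (x ∷ p) (there s) with step-map⁻ p s
  ... | x' , y' , s' , eqs = x' , y' , there s' , eqs

path-walk : ∀ x → Walk (low (word x)) (low (map not (word x))) (path x)
path-walk leaf       = stop
path-walk (node u v) = subst (λ z → Walk (low (word (node u v))) (low z) (path (node u v))) (sym (not-word u v))
  (go _ (walk-++ (walk-map (innerV v) (path-walk u)) (walk-map (outerV u) (path-walk v))))

edge-map : ∀ {A B : Set} (f : A → B) {x y p} → Edge p x y → Edge (map f p) (f x) (f y)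
edge-map f = Sum.map (step-map f) (step-map f)

first-step : ∀ {A : Set} {x y z : A} {p} → Walk y z p → Step (x ∷ p) x y
first-step stop     = here
first-step (go _ _) = here

slot-edge : ∀ {x} (e : Slot x) → Edge (path x) (low (lo e)) (high (hi e))
slot-edge {node u v} enter = inj₁ (first-step (walk-++ (walk-map (innerV v) (path-walk u)) (walk-map (outerV u) (path-walk v))))
slot-edge {node u v} leave = inj₂ (there (step-join (walk-map (innerV v) (path-walk u)) (walk-map (outerV u) (path-walk v))))
slot-edge {node u v} (inU e) = Sum.map (λ s → there (step-++ˡ s)) (λ s → there (step-++ˡ s)) (Sum.swap (edge-map (innerV v) (slot-edge e)))
slot-edge {node u v} (inV e) = Sum.map (λ s → there (step-++ʳ _ s)) (λ s → there (step-++ʳ _ s)) (edge-map (outerV u) (slot-edge e))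

path-flip : ∀ x {p q} → Step (path x) p q → Flip p q
path-flip leaf (there ())
path-flip (node u v) s
  with step-++⁻ stop (walk-++ (walk-map (innerV v) (path-walk u)) (walk-map (outerV u) (path-walk v))) s
... | inj₁ (there ())
... | inj₂ (inj₁ (refl , refl)) = up (slot-⋖ {node u v} enter)
... | inj₂ (inj₂ t) with step-++⁻ (walk-map (innerV v) (path-walk u)) (walk-map (outerV u) (path-walk v)) t
...   | inj₂ (inj₁ (refl , refl)) = down (slot-⋖ {node u v} leave)
...   | inj₁ r with step-map⁻ (innerV v) (path u) r
...     | _ , _ , r' , refl , refl = innerV-flip v (path-flip u r')
path-flip (node u v) s | inj₂ (inj₂ t) | inj₂ (inj₂ r) with step-map⁻ (outerV u) (path v) r
...     | _ , _ , r' , refl , refl = outerV-flip u (path-flip v r')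

-- Merging cycles

Pred : Set₁
Pred = Dyck → Set

Marks : Set₁
Marks = (x : Dyck) → Slot x → Set

record Partition (Z X Y : Pred) : Set where
  constructor partition
  field
    split  : ∀ {x} → Z x → X x ⊎ Y x
    left   : ∀ {x} → X x → Z x
    right  : ∀ {x} → Y x → Z x
    apart  : ∀ {x} → X x → Y x → ⊥

swap-partition : ∀ {Z X Y} → Partition Z X Y → Partition Z Y X
swap-partition (partition s l r d) = partition (λ z → Sum.swap (s z)) r l (λ y x → d x y)

data Same-slot {x : Dyck} (e : Slot x) : (y : Dyck) → Slot y → Set where
  same : Same-slot e x e

-- Glued X A M: the cycles of the words in X are merged into one cycle, which
-- contains the slots in A and avoids the slots in M.  Chain s t X A M: the same for
-- a path from s on the lower level to t on the upper level, obtained by opening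
-- merged cycles at available slots and linking the results.  A closed chain has at
-- least two parts, since closing a single part would restore the opened slot.
mutual
  data Glued : Pred → Marks → Marks → Set₁ where
    single : ∀ x → Glued (_≡ x) (λ _ _ → ⊤) (λ _ _ → ⊥)
    close  : ∀ {s t s' t' X Y Z A M} → Chain s t X A M → s' ⋖ t → Chain s' t' Y A M → s ⋖ t' → Partition Z X Y → Glued Z A M
    weaken : ∀ {X A M X' A' M'} → (∀ {x} → X x → X' x) → (∀ {x} → X' x → X x) →
             (∀ x e → X x → A' x e → A x e) → (∀ x e → X x → M' x e → M x e) → Glued X A M → Glued X' A' M'

  data Chain : Str → Str → Pred → Marks → Marks → Set₁ where
    cut-open : ∀ {X A M A' M' x} (e : Slot x) → Glued X A M → X x → A x e →
               (∀ y f → X y → A' y f → A y f × ¬ Same-slot e y f) →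
               (∀ y f → X y → M' y f → M y f ⊎ Same-slot e y f) → Chain (lo e) (hi e) X A' M'
    link     : ∀ {s t s' t' X Y Z A M} → Chain s t X A M → s' ⋖ t → Chain s' t' Y A M → Partition Z X Y → Chain s t' Z A M

record Cycle (X : Pred) (A M : Marks) : Set where
  field
    first last : Vertex
    list   : List Vertex
    walk   : Walk first last list
    simple : Unique list
    ∈⇒     : ∀ {p} → p ∈ list → ∃ λ x → X x × p ∈ path x
    ∈⇐     : ∀ {p x} → X x → p ∈ path x → p ∈ list
    adj    : ∀ {p q} → Cyclic first last list p q → Adj p q
    avail  : ∀ x e → X x → A x e → Cyclic first last list (low (lo e)) (high (hi e))
    used   : ∀ x e → X x → M x e → ¬ Cyclic first last list (low (lo e)) (high (hi e))

record Path (s t : Str) (X : Pred) (A M : Marks) : Set where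
  field
    list   : List Vertex
    walk   : Walk (low s) (high t) list
    simple : Unique list
    ∈⇒     : ∀ {p} → p ∈ list → ∃ λ x → X x × p ∈ path x
    ∈⇐     : ∀ {p x} → X x → p ∈ path x → p ∈ list
    adj    : ∀ {p q} → Edge list p q → Adj p q
    avail  : ∀ x e → X x → A x e → Edge list (low (lo e)) (high (hi e))
    used   : ∀ x e → X x → M x e → ¬ Edge list (low (lo e)) (high (hi e))

module Two {s t s' t' X Y Z A M} (P : Path s t X A M) (f : s' ⋖ t) (Q : Path s' t' Y A M) (part : Partition Z X Y) where
  module P = Path P
  module Q = Path Q
  open Partition part

  disjoint : ∀ {p} → p ∈ P.list → p ∈ Q.list → ⊥
  disjoint i j with P.∈⇒ i | Q.∈⇒ j
  ... | x , Xx , p | y , Yy , q with path-disjoint x y p q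
  ...   | refl = apart Xx Yy

  joined : Path s t' Z A M
  joined = record
    { list   = P.list ++ Q.list
    ; walk   = walk-++ P.walk Q.walk
    ; simple = Unique.++⁺ P.simple Q.simple (λ { (i , j) → disjoint i j })
    ; ∈⇒     = λ i → [ (λ j → let x , Xx , p = P.∈⇒ j in x , left Xx , p) , (λ j → let x , Xx , p = Q.∈⇒ j in x , right Xx , p) ]′ (∈-++⁻ P.list i)
    ; ∈⇐     = λ z p → [ (λ Xx → ∈-++⁺ˡ (P.∈⇐ Xx p)) , (λ Yx → ∈-++⁺ʳ P.list (Q.∈⇐ Yx p)) ]′ (split z)
    ; adj    = λ { (inj₁ e) → adj e ; (inj₂ e) → adj-sym (adj e) }
    ; avail  = λ x e z α → [ (λ Xx → Sum.map step-++ˡ step-++ˡ (P.avail x e Xx α))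
                           , (λ Yx → Sum.map (step-++ʳ P.list) (step-++ʳ P.list) (Q.avail x e Yx α)) ]′ (split z)
    ; used   = λ x e z μ g → [ (λ Xx → P.used x e Xx μ (edge-restrict P.walk Q.walk disjoint (P.∈⇐ Xx (lo∈ e)) (P.∈⇐ Xx (hi∈ e)) g))
                             , (λ Yx → Q.used x e Yx μ (edge-restrictʳ P.walk Q.walk disjoint (Q.∈⇐ Yx (lo∈ e)) (Q.∈⇐ Yx (hi∈ e)) g)) ]′ (split z)
    }
    where
    adj : ∀ {p q} → Step (P.list ++ Q.list) p q → Adj p q
    adj g with step-++⁻ P.walk Q.walk g
    ... | inj₁ h                    = P.adj (inj₁ h)
    ... | inj₂ (inj₁ (refl , refl)) = flips (down f)
    ... | inj₂ (inj₂ h)             = Q.adj (inj₁ h)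

  closed : s ⋖ t' → Cycle Z A M
  closed g = record
    { first  = low s
    ; last   = high t'
    ; list   = J.list
    ; walk   = J.walk
    ; simple = J.simple
    ; ∈⇒     = J.∈⇒
    ; ∈⇐     = J.∈⇐
    ; adj    = λ { (inj₁ e) → J.adj e ; (inj₂ (inj₁ (refl , refl))) → flips (down g) ; (inj₂ (inj₂ (refl , refl))) → flips (up g) }
    ; avail  = λ x e z α → inj₁ (J.avail x e z α)
    ; used   = λ { x e z μ (inj₁ h) → J.used x e z μ h
                 ; x e z μ (inj₂ (inj₁ ()))
                 ; x e z μ (inj₂ (inj₂ (h₁ , h₂))) → ends x e z h₁ h₂ }
    }
    where
    module J = Path joined
    -- The closing edge runs between two disjoint parts, while both ends of a slot lie in one part;
    -- so closing restores no used slot.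
    ends : ∀ x (e : Slot x) → Z x → low (lo e) ≡ low s → high (hi e) ≡ high t' → ⊥
    ends x e z h₁ h₂ with split z
    ... | inj₁ Xx = disjoint (P.∈⇐ Xx (hi∈ e)) (subst (_∈ Q.list) (sym h₂) (last∈ Q.walk))
    ... | inj₂ Yx = disjoint (subst (_∈ P.list) (sym h₁) (first∈ P.walk)) (Q.∈⇐ Yx (lo∈ e))

low-injective : ∀ {s t} → low s ≡ low t → s ≡ t
low-injective = cong proj₂

cycle : ∀ {X A M} → Glued X A M → Cycle X A M
chain : ∀ {s t X A M} → Chain s t X A M → Path s t X A M
cycle (single x) = record
  { first  = low (word x)
  ; last   = low (map not (word x))
  ; list   = path x
  ; walk   = path-walk x
  ; simple = path-unique x
  ; ∈⇒     = λ i → x , refl , i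
  ; ∈⇐     = λ { refl i → i }
  ; adj    = λ { (inj₁ (inj₁ s)) → flips (path-flip x s) ; (inj₁ (inj₂ s)) → flips (flip-sym (path-flip x s))
               ; (inj₂ (inj₁ (refl , refl))) → cross′ (word x) ; (inj₂ (inj₂ (refl , refl))) → cross (word x) }
  ; avail  = λ { _ e refl _ → inj₁ (slot-edge e) }
  ; used   = λ _ _ _ ()
  }
cycle (close c f d g part) = Two.closed (chain c) f (chain d) part g
cycle (weaken i j α μ g) = record
  { walk = walk ; simple = simple ; adj = adj
  ; ∈⇒    = λ p → let x , Xx , q = ∈⇒ p in x , i Xx , q
  ; ∈⇐    = λ X'x → ∈⇐ (j X'x)
  ; avail = λ x e X'x A' → avail x e (j X'x) (α x e (j X'x) A')
  ; used  = λ x e X'x M' → used x e (j X'x) (μ x e (j X'x) M')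
  }
  where open Cycle (cycle g)
chain (cut-open {X} {A' = A'} {M' = M'} {x = x} e g Xx Ae α μ) = record
  { list   = O.list
  ; walk   = O.walk
  ; simple = O.simple
  ; ∈⇒     = λ i → C.∈⇒ (O.∈⇒ i)
  ; ∈⇐     = λ Xy i → O.∈⇐ (C.∈⇐ Xy i)
  ; adj    = λ h → C.adj (O.edge⇒ h)
  ; avail  = λ y f Xy A'f → avail y f Xy (α y f Xy A'f)
  ; used   = λ y f Xy M'f → used y f Xy (μ y f Xy M'f)
  }
  where
  module C = Cycle (cycle g)
  opened : Opened C.first C.last C.list (low (lo e)) (high (hi e))
  opened = open-cyclic C.walk C.simple (C.avail x e Xx Ae)
  module O = Opened opened
  same-slot : ∀ {x y} (e : Slot x) (f : Slot y) → lo f ≡ lo e → hi f ≡ hi e → Same-slot e y f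
  same-slot {x} {y} e f l h with path-disjoint y x (lo∈ f) (subst (λ z → low z ∈ path x) (sym l) (lo∈ e))
  ... | refl with slot-injective f e l h
  ...   | refl = same
  avail : ∀ y f → X y → _ × ¬ Same-slot e y f → Edge O.list (low (lo f)) (high (hi f))
  avail y f Xy (Af , e≢f) with O.edge⇐ (C.avail y f Xy Af)
  ... | inj₁ h              = h
  ... | inj₂ (inj₁ (l , h)) = ⊥-elim (e≢f (same-slot e f (low-injective l) (cong proj₂ h)))
  ... | inj₂ (inj₂ (() , _))
  used : ∀ y f → X y → _ ⊎ Same-slot e y f → ¬ Edge O.list (low (lo f)) (high (hi f))
  used y f Xy (inj₁ Mf)   h = C.used y f Xy Mf (O.edge⇒ h)
  -- The slot just opened joins the two ends of the new path, so `no-chord` applies.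
  used y f Xy (inj₂ same) h with third e
  ... | s , s∈ , s≢ = no-chord O.walk O.simple (O.∈⇐ (C.∈⇐ Xy s∈)) (λ eq → s≢ (low-injective eq)) (λ ()) h
chain (link c f d part) = Two.joined (chain c) f (chain d) part

∅ : Marks
∅ _ _ = ⊥

Size : ℕ → Pred
Size n x = size x ≡ n

Prod : Pred → Pred → Pred
Prod X Y leaf       = ⊥
Prod X Y (node u v) = X u × Y v

-- Merging patterns inside a larger word

LiftA LiftM : Marks → Marks
LiftA A (node u v) (inV e) = A v e
LiftA A (node u v) _       = ⊤
LiftM M (node u v) (inV e) = M v e
LiftM M (node u v) _       = ⊥

prod-partitionʳ : ∀ {Z X Y W} → Partition Z X Y → Partition (Prod W Z) (Prod W X) (Prod W Y)
prod-partitionʳ part = partition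
  (λ { {node u v} (w , z) → Sum.map (w ,_) (w ,_) (split z) })
  (λ { {node u v} (w , z) → w , left z })
  (λ { {node u v} (w , z) → w , right z })
  (λ { {node u v} (_ , x) (_ , y) → apart x y })
  where open Partition part

prod-partitionˡ : ∀ {Z X Y W} → Partition Z X Y → Partition (Prod Z W) (Prod X W) (Prod Y W)
prod-partitionˡ part = partition
  (λ { {node u v} (z , w) → Sum.map (_, w) (_, w) (split z) })
  (λ { {node u v} (z , w) → left z , w })
  (λ { {node u v} (z , w) → right z , w })
  (λ { {node u v} (x , _) (y , _) → apart x y })
  where open Partition part

-- `outer u` copies the path of `v` edge by edge with its levels unchanged, and a pattern opens path
-- edges only, never an edge between complementary strings. It can therefore be repeated verbatim on
-- the words `node u v`, leaving all slots outside that copy untouched.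
lift : ∀ u {X A M} → Glued X A M → Glued (Prod (_≡ u) X) (LiftA A) (LiftM M)
lift-chain : ∀ u {s t X A M} → Chain s t X A M → Chain (outer u s) (outer u t) (Prod (_≡ u) X) (LiftA A) (LiftM M)
lift u (single v) = weaken (λ { refl → refl , refl }) (λ { {node _ _} (refl , refl) → refl })
  (λ _ _ _ _ → tt) (λ { (node _ _) (inV e) _ () }) (single (node u v))
lift u (close c f d g part) = close (lift-chain u c) (outer-⋖ u f) (lift-chain u d) (outer-⋖ u g) (prod-partitionʳ part)
lift u (weaken i j α μ g) = weaken
  (λ { {node _ _} (w , x) → w , i x }) (λ { {node _ _} (w , x) → w , j x })
  (λ { (node _ _) (inV e) (_ , x) A' → α _ e x A' ; (node _ _) enter _ _ → tt ; (node _ _) leave _ _ → tt ; (node _ _) (inU _) _ _ → tt })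
  (λ { (node _ _) (inV e) (_ , x) M' → μ _ e x M' })
  (lift u g)
lift-chain u (cut-open e g Xx Ae α μ) = cut-open (inV e) (lift u g) (refl , Xx) Ae
  (λ { (node _ _) (inV f) (_ , x) A' → let Af , e≢f = α _ f x A' in Af , λ { same → e≢f same }
     ; (node _ _) enter _ _ → tt , λ () ; (node _ _) leave _ _ → tt , λ () ; (node _ _) (inU _) _ _ → tt , λ () })
  (λ { (node _ _) (inV f) (refl , x) M' → Sum.map₂ (λ { same → same }) (μ _ f x M') })
lift-chain u (link c f d part) = link (lift-chain u c) (outer-⋖ u f) (lift-chain u d) (prod-partitionʳ part)

ProdA : Marks → Marks → Marks
ProdA A B (node u v) (inU e) = A u e
ProdA A B (node u v) (inV e) = B v e
ProdA A B (node u v) _       = ⊤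

-- The pattern for the left parts is carried out at the right part `v₀` only, so its used slots are
-- used there and nowhere else.
ProdM : Dyck → Marks → Marks → Marks
ProdM v₀ M N (node u v) (inU e) = v ≡ v₀ × M u e
ProdM v₀ M N (node u v) (inV e) = N v e
ProdM v₀ M N (node u v) _       = ⊥

-- For every u the words node u v are merged along h; these cycles are then merged
-- with one another along a pattern for u placed at the single word v₀.
module _ {Y B N} (h : Glued Y B N) {v₀ : Dyck} (Yv₀ : Y v₀) where

  product : ∀ {X A M} → Glued X A M → Glued (Prod X Y) (ProdA A B) (ProdM v₀ M N)
  product-chain : ∀ {s t X A M} → Chain s t X A M → Chain (inner v₀ t) (inner v₀ s) (Prod X Y) (ProdA A B) (ProdM v₀ M N)
  product (single u) = weaken id id
    (λ { (node _ _) (inV e) _ A' → A' ; (node _ _) enter _ _ → tt ; (node _ _) leave _ _ → tt ; (node _ _) (inU _) _ _ → tt })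
    (λ { (node _ _) (inV e) _ M' → M' })
    (lift u h)
  -- `inner` exchanges the levels, so each chain is run backwards and the two parts trade places.
  product (close c f d g part) =
    close (product-chain d) (inner-⋖ v₀ f) (product-chain c) (inner-⋖ v₀ g) (prod-partitionˡ (swap-partition part))
  product (weaken i j α μ g) = weaken
    (λ { {node _ _} (x , w) → i x , w }) (λ { {node _ _} (x , w) → j x , w })
    (λ { (node _ _) (inU e) (x , _) A' → α _ e x A' ; (node _ _) (inV e) _ A' → A' ; (node _ _) enter _ _ → tt ; (node _ _) leave _ _ → tt })
    (λ { (node _ _) (inU e) (x , _) (v≡ , M') → v≡ , μ _ e x M' ; (node _ _) (inV e) _ M' → M' })
    (product g)
  product-chain (cut-open e g Xx Ae α μ) = cut-open (inU e) (product g) (Xx , Yv₀) Ae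
    (λ { (node _ _) (inU f) (x , _) A' → let Af , e≢f = α _ f x A' in Af , λ { same → e≢f same }
       ; (node _ _) enter _ _ → tt , λ () ; (node _ _) leave _ _ → tt , λ () ; (node _ _) (inV _) _ A' → A' , λ () })
    (λ { (node _ _) (inU f) (x , _) (refl , M') → Sum.map (refl ,_) (λ { same → same }) (μ _ f x M')
       ; (node _ _) (inV f) _ M' → inj₁ M' })
  product-chain (link c f d part) = link (product-chain d) (inner-⋖ v₀ f) (product-chain c) (prod-partitionˡ (swap-partition part))

-- The alternating cycles

o : Dyck
o = node leaf leaf

-- With s' the reverse complement of s, the words are x₁ = 1s'11000t,
-- x₂ = 1s'10100t, x₃ = 1s'10010t, y₁ = 110010t and y₂ = 101100t.
y₁ y₂ : Dyck → Dyck
x₁ x₂ x₃ : Dyck → Dyck → Dyck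
x₁ s t = node (node o s) t
x₂ s t = node (node leaf (node leaf s)) t
x₃ s t = node (node leaf s) (node leaf t)
y₁ t = node o (node leaf t)
y₂ t = node leaf (node o t)

-- The 6-cycle consists of the strings `1s'*01**t` whose three stars are not all equal: the two
-- middle levels of a 3-cube. Three alternate edges are the given slots, the other three are the
-- linking flips.
hexagon : ∀ s t {X Y W V Z A M} →
  Chain (lo {x₁ s t} (inU leave)) (hi {x₁ s t} (inU leave)) X A M →
  Chain (lo {x₃ s t} (inU enter)) (hi {x₃ s t} (inU enter)) Y A M →
  Chain (lo {x₂ s t} enter) (hi {x₂ s t} enter) W A M →
  Partition V X Y → Partition Z V W → Glued Z A M
hexagon s t c d e p q = close (link c (there (⋖-ʳ++ (map not (word s)) (there (there (there (there here)))))) d p)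
  (there (⋖-ʳ++ (map not (word s)) (there (there (there here))))) e
  (there (⋖-ʳ++ (map not (word s)) here)) q

-- The 8-cycle consists of the strings `1**1**t` whose four stars, taken cyclically, contain a
-- single 1 or two adjacent ones. Its edges are alternately slots and linking flips.
octagon : ∀ t {X Y W V Z Z₁ Z₂ A M} →
  Chain (lo {x₁ leaf t} (inU leave)) (hi {x₁ leaf t} (inU leave)) X A M →
  Chain (lo {y₁ t} (inU leave)) (hi {y₁ t} (inU leave)) Y A M →
  Chain (lo {y₂ t} enter) (hi {y₂ t} enter) W A M →
  Chain (lo {x₂ leaf t} enter) (hi {x₂ leaf t} enter) V A M →
  Partition Z₁ X Y → Partition Z₂ Z₁ W → Partition Z Z₂ V → Glued Z A M
octagon t c d e f p q r = close (link (link c (there (there (there (there (there here))))) d p) (there (there (there (there here)))) e q)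
  (there (there here)) f (there here) r

-- Slots to be preserved during the induction.

comb : ℕ → Dyck
comb zero    = leaf
comb (suc n) = node leaf (comb n)

size-comb : ∀ n → size (comb n) ≡ n
size-comb zero    = refl
size-comb (suc n) = cong suc (size-comb n)

-- Slots recording a binary choice, coming from the words 10v and from the words 1u0.
data Marked (F G : Marks) : Marks where
  base : ∀ {v e} → F v e → Marked F G (node leaf v) (inV e)
  top  : ∀ {u e} → G u e → Marked F G (node u leaf) (inU e)

-- Slots that the patterns for two halves leave available, besides those in A.
data Keep (A : Marks) : Marks where
  mark  : ∀ {x e} → A x e → Keep A x e
  spine : ∀ n → Keep A (comb (suc n)) enter
  hook  : ∀ {u v} → Keep A (node u v) leave

-- The two distinguished members are the left parts of `x₂ (comb m) t` and `x₁ (comb m) t`, so a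
-- single `hexagon` reaches both halves.
record Halves (m : ℕ) (A M : Marks) : Set₁ where
  field
    PA PB : Pred
    gA    : Glued PA (Keep A) M
    gB    : Glued PB (Keep A) M
    halves : Partition (Size (2 + m)) PA PB
    combA : PA (comb (2 + m))
    hookB : PB (node o (comb m))

-- Slots that are still available after merging the words node u v with u of
-- bounded size; Q j v says that the connecting slot at u = comb (1 + j) is unused.
data Stage (F G : Marks) (Q : ℕ → Dyck → Set) : Marks where
  mark : ∀ {x e} → Marked F G x e → Stage F G Q x e
  step : ∀ j {v} → Q j v → Stage F G Q (node (comb (suc j)) v) (inU enter)
  hook : ∀ {u v} → Stage F G Q (node u v) leave

same-dyck : ∀ {x y} {e : Slot x} {f : Slot y} → Same-slot e y f → x ≡ y
same-dyck same = refl

-- A coarse code for the position of a slot; different codes refute `Same-slot` when the words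
-- involved are not in constructor form.
kind : ∀ {x} → Slot x → ℕ
kind enter   = 0
kind leave   = 1
kind (inV _) = 2
kind (inU e) = 3 + kind e

same-kind : ∀ {x y} {e : Slot x} {f : Slot y} → Same-slot e y f → kind e ≡ kind f
same-kind same = refl

left-part right-part : Dyck → Dyck
left-part leaf = leaf
left-part (node u v) = u
right-part leaf = leaf
right-part (node u v) = v

-- `attach` opens `x₁ (comb m) t` at `inU leave`, so no recorded choice may sit in a `leave` slot of
-- a left part.
No-leave : Marks → Set
No-leave G = ∀ {u v} → ¬ G (node u v) leave

-- Attaching words with a longer left part.

module _ {F G F' G' : Marks} (nl : No-leave G) where

  -- `product` turns each half of the left parts of size `2 + m` into one cycle over all right parts
  -- in `V`, and the 6-cycle joins both to `Y`. It spends the connecting slot of `x₃ (comb m) t`,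
  -- which `Q'` therefore excludes. Choices of kind `top` live at right part `leaf`; only if `V`
  -- contains `leaf` must the halves carry them.
  attach : ∀ m t {Y V Z H H'} {Q Q' : ℕ → Dyck → Set} →
    Glued Y (Stage F G Q) (Marked F' G') → Y (x₃ (comb m) t) → Q m (node leaf t) →
    (∀ {j v} → Q' j v → Q j v) → ¬ Q' m (node leaf t) →
    Halves m H H' → Glued V ∅ ∅ → V t →
    (V leaf → t ≡ leaf × (∀ u e → G u e → H u e) × (∀ u e → G' u e → H' u e)) →
    Partition Z Y (Prod (Size (2 + m)) V) → Glued Z (Stage F G Q') (Marked F' G')
  attach m t {Y} {V} {Z} {H} {H'} {Q} {Q'} gY Yx Qt Q'⊆Q ¬Q' halves gV Vt marks part = hexagon (comb m) t
    (cut-open (inU leave) (product gV Vt gB) (hookB , Vt) hook αB (μ (Partition.right halves')))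
    (cut-open (inU enter) gY Yx (step m Qt) αY (λ _ _ _ → inj₁))
    (cut-open enter (product gV Vt gA) (combA , Vt) tt αA (μ (Partition.left halves')))
    (partition {Z = λ x → Prod PB V x ⊎ Y x} id inj₁ inj₂
      λ { {node _ _} (b , w) y → apart y (Partition.right halves' b , w) })
    (partition
      (λ z → [ (λ y → inj₁ (inj₂ y)) , split-prod ]′ (split z))
      [ from-B , left ]′
      (λ { {node _ _} (b , w) → right (Partition.left halves' b , w) })
      (λ { {node _ _} (inj₁ (b , w)) (b' , w') → Partition.apart halves' b' b
         ; {node _ _} (inj₂ y) (b' , w') → apart y (Partition.left halves' b' , w') }))
    where
    open Halves halves renaming (halves to halves')
    open Partition part
    split-prod : ∀ {x} → Prod (Size (2 + m)) V x → (Prod PB V x ⊎ Y x) ⊎ Prod PA V x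
    split-prod {node _ _} (s , w) = [ (λ a → inj₂ (a , w)) , (λ b → inj₁ (inj₁ (b , w))) ]′ (Partition.split halves' s)
    from-B : ∀ {x} → Prod PB V x → Z x
    from-B {node _ _} (b , w) = right (Partition.right halves' b , w)
    αB : ∀ y f → Prod PB V y → Stage F G Q' y f → ProdA (Keep H) ∅ y f × ¬ Same-slot {x₁ (comb m) t} (inU leave) y f
    αB _ _ (x , w) (mark (base _)) with Partition.right halves' x
    ... | ()
    αB _ _ (x , w) (mark (top {u} {e} g)) = mark (proj₁ (proj₂ (marks w)) u e g) , λ { same → nl g }
    αB _ _ (x , w) (step j q) = spine j , λ s → case same-kind s of λ ()
    αB _ _ (x , w) hook = tt , λ ()
    αA : ∀ y f → Prod PA V y → Stage F G Q' y f → ProdA (Keep H) ∅ y f × ¬ Same-slot {x₂ (comb m) t} enter y f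
    αA _ _ (x , w) (mark (base _)) with Partition.left halves' x
    ... | ()
    αA _ _ (x , w) (mark (top {u} {e} g)) = mark (proj₁ (proj₂ (marks w)) u e g) , λ s → case same-kind s of λ ()
    αA _ _ (x , w) (step j q) = spine j , λ s → case same-kind s of λ ()
    αA _ _ (x , w) hook = tt , λ ()
    αY : ∀ y f → Y y → Stage F G Q' y f → Stage F G Q y f × ¬ Same-slot {x₃ (comb m) t} (inU enter) y f
    αY _ _ y (mark k@(base _)) = mark k , λ ()
    αY _ _ y (mark k@(top _))  = mark k , λ ()
    αY _ _ y hook              = hook , λ ()
    αY _ _ y (step j {v} q)    = step j (Q'⊆Q q) , λ s → ¬Q' (subst₂ Q' (same-j s) (sym (cong right-part (same-dyck s))) q)
      where
      same-j : Same-slot {x₃ (comb m) t} (inU enter) (node (comb (suc j)) v) (inU enter) → j ≡ m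
      same-j s = sym (trans (sym (size-comb m)) (trans (cong (λ x → size (right-part (left-part x))) (same-dyck s)) (size-comb j)))
    μ : ∀ {P : Pred} → (∀ {x} → P x → Size (2 + m) x) → ∀ {x} {e : Slot x} y f → Prod P V y → Marked F' G' y f → ProdM t H' ∅ y f ⊎ Same-slot e y f
    μ sz _ _ (x , w) (base _) with sz x
    ... | ()
    μ sz _ _ (x , w) (top {u} {e} g) = inj₁ (sym (proj₁ (marks w)) , proj₂ (proj₂ (marks w)) u e g)

  -- The left parts in `hexagon` are never `leaf`, so it cannot reach the words 10v. The 8-cycle
  -- does so through `y₂ t`, and at once joins left parts of sizes 0 and 1 with both halves of size
  -- 2.
  attach₄ : ∀ {k k'} t {V Z} {Q : ℕ → Dyck → Set} →
    Glued (Prod (_≡ leaf) (Size (suc k))) (LiftA F) (LiftM F') → Glued (Prod (_≡ o) (Size (suc k'))) (LiftA ∅) (LiftM ∅) →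
    Size k' t → Size (suc k) (node o t) →
    Halves 0 ∅ ∅ → Glued V ∅ ∅ → V t → ¬ V leaf →
    Partition Z (λ x → Prod (_≡ leaf) (Size (suc k)) x ⊎ Prod (_≡ o) (Size (suc k')) x) (Prod (Size 2) V) →
    Glued Z (Stage F G Q) (Marked F' G')
  attach₄ {k} {k'} t {V} {Z} {Q} g₀ g₁ size-t size-ot halves gV Vt ¬Vleaf part = octagon t
    (cut-open (inU leave) (product gV Vt gB) (hookB , Vt) hook (α₂ (Partition.right halves') (λ ()) (λ ())) (μ₂ (Partition.right halves')))
    (cut-open (inU leave) g₁ (refl , cong suc size-t) tt α₁ μ₁)
    (cut-open enter g₀ (refl , size-ot) tt α₀ μ₀)
    (cut-open enter (product gV Vt gA) (combA , Vt) tt (α₂ (Partition.left halves') (λ ()) (λ ())) (μ₂ (Partition.left halves')))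
    (partition {Z = λ x → Prod PB V x ⊎ C₁ x} id inj₁ inj₂
      λ { {node _ _} (p , w) y → apart (inj₂ y) (Partition.right halves' p , w) })
    (partition {Z = λ x → (Prod PB V x ⊎ C₁ x) ⊎ C₀ x} id inj₁ inj₂
      λ { {node _ _} (inj₁ (p , w)) y → apart (inj₁ y) (Partition.right halves' p , w) ; {node _ _} (inj₂ (refl , _)) (() , _) })
    (partition
      (λ z → [ [ (λ y → inj₁ (inj₂ y)) , (λ y → inj₁ (inj₁ (inj₂ y))) ]′ , split-prod ]′ (split z))
      [ [ from-B , (λ y → left (inj₂ y)) ]′ , (λ y → left (inj₁ y)) ]′
      (λ { {node _ _} (p , w) → right (Partition.left halves' p , w) })
      (λ { {node _ _} (inj₁ (inj₁ (p , w))) (p' , w') → Partition.apart halves' p' p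
         ; {node _ _} (inj₁ (inj₂ y)) (p' , w') → apart (inj₂ y) (Partition.left halves' p' , w')
         ; {node _ _} (inj₂ y) (p' , w') → apart (inj₁ y) (Partition.left halves' p' , w') }))
    where
    open Halves halves renaming (halves to halves')
    open Partition part
    C₀ C₁ : Pred
    C₀ = Prod (_≡ leaf) (Size (suc k))
    C₁ = Prod (_≡ o) (Size (suc k'))
    split-prod : ∀ {x} → Prod (Size 2) V x → ((Prod PB V x ⊎ C₁ x) ⊎ C₀ x) ⊎ Prod PA V x
    split-prod {node _ _} (s , w) = [ (λ p → inj₂ (p , w)) , (λ p → inj₁ (inj₁ (inj₁ (p , w)))) ]′ (Partition.split halves' s)
    from-B : ∀ {x} → Prod PB V x → Z x
    from-B {node _ _} (p , w) = right (Partition.right halves' p , w)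
    α₂ : ∀ {P : Pred} → (∀ {x} → P x → Size 2 x) → ∀ {x} {e : Slot x} → kind e ≢ 3 → kind e ≢ 1 → ∀ y f → Prod P V y → Stage F G Q y f → ProdA (Keep ∅) ∅ y f × ¬ Same-slot e y f
    α₂ sz _ _ _ _ (x , w) (mark (base _)) with sz x
    ... | ()
    α₂ sz _ _ _ _ (x , w) (mark (top _)) = ⊥-elim (¬Vleaf w)
    α₂ sz ne _ _ _ (x , w) (step j q)    = spine j , λ s → ne (same-kind s)
    α₂ sz _ nl _ _ (x , w) hook          = tt , λ s → nl (same-kind s)
    μ₂ : ∀ {P : Pred} → (∀ {x} → P x → Size 2 x) → ∀ {x} {e : Slot x} y f → Prod P V y → Marked F' G' y f → ProdM t ∅ ∅ y f ⊎ Same-slot e y f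
    μ₂ sz _ _ (x , w) (base _) with sz x
    ... | ()
    μ₂ sz _ _ (x , w) (top _) = ⊥-elim (¬Vleaf w)
    α₁ : ∀ y f → C₁ y → Stage F G Q y f → LiftA ∅ y f × ¬ Same-slot {y₁ t} (inU leave) y f
    α₁ _ _ (() , _) (mark (base _))
    α₁ _ _ (_ , ()) (mark (top _))
    α₁ _ _ _ (step j q) = tt , λ s → case same-kind s of λ ()
    α₁ _ _ _ hook       = tt , λ ()
    μ₁ : ∀ y f → C₁ y → Marked F' G' y f → LiftM ∅ y f ⊎ Same-slot {y₁ t} (inU leave) y f
    μ₁ _ _ (() , _) (base _)
    μ₁ _ _ (_ , ()) (top _)
    α₀ : ∀ y f → C₀ y → Stage F G Q y f → LiftA F y f × ¬ Same-slot {y₂ t} enter y f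
    α₀ _ _ _ (mark (base m)) = m , λ ()
    α₀ _ _ (_ , ()) (mark (top _))
    α₀ _ _ (() , _) (step j q)
    α₀ _ _ _ hook            = tt , λ ()
    μ₀ : ∀ y f → C₀ y → Marked F' G' y f → LiftM F' y f ⊎ Same-slot {y₂ t} enter y f
    μ₀ _ _ _ (base m) = inj₁ m
    μ₀ _ _ (_ , ()) (top _)

Range : ℕ → ℕ → ℕ → Pred
Range l h k leaf       = ⊥
Range l h k (node u v) = l ≤ size u × size u ≤ h × size u + size v ≡ k

range-step : ∀ {l m d k} → l ≤ suc m → suc m + d ≡ k → Partition (Range l (suc m) k) (Range l m k) (Prod (Size (suc m)) (Size d))
range-step {l} {m} {d} {k} l≤ m+d≡k = partition
  (λ { {node u v} (l≤u , u≤ , eq) → case m≤n⇒m<n∨m≡n u≤ of λ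
       { (inj₁ (s≤s u≤m)) → inj₁ (l≤u , u≤m , eq)
       ; (inj₂ u≡)        → inj₂ (u≡ , +-cancelˡ-≡ (suc m) _ _ (trans (cong (_+ size v) (sym u≡)) (trans eq (sym m+d≡k)))) } })
  (λ { {node u v} (l≤u , u≤ , eq) → l≤u , ≤-trans u≤ (n≤1+n _) , eq })
  (λ { {node u v} (u≡ , v≡) → subst (l ≤_) (sym u≡) l≤ , ≤-reflexive u≡ , trans (cong₂ _+_ u≡ v≡) m+d≡k })
  (λ { {node u v} (_ , u≤ , _) (u≡ , _) → <-irrefl u≡ (s≤s u≤) })

size≡0 : ∀ {x} → Size 0 x → x ≡ leaf
size≡0 {leaf} _ = refl

size≡1 : ∀ {x} → Size 1 x → x ≡ o
size≡1 {node leaf leaf} _ = refl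
size≡1 {node leaf (node _ _)} ()
size≡1 {node (node _ _) _} ()

t₁ t₂ : Dyck
t₁ = node o leaf
t₂ = node leaf o

size≡2 : ∀ {x} → Size 2 x → x ≡ t₁ ⊎ x ≡ t₂
size≡2 {node leaf v} eq = inj₂ (cong (node leaf) (size≡1 (suc-injective eq)))
size≡2 {node (node leaf leaf) leaf} eq = inj₁ refl
size≡2 {node (node leaf leaf) (node _ _)} ()
size≡2 {node (node leaf (node _ _)) _} ()
size≡2 {node (node (node _ _) _) _} ()

⟨0⟩ : Glued (Size 0) ∅ ∅
⟨0⟩ = weaken (λ { refl → refl }) size≡0 (λ _ _ _ ()) (λ _ _ _ ()) (single leaf)

only : ∀ x → Glued (_≡ x) ∅ ∅
only x = weaken id id (λ _ _ _ ()) (λ _ _ _ ()) (single x)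

-- The two words of size 2 cannot be merged with each other, so as right parts they are attached one
-- after the other.
prod-pair : ∀ {Y Z X} → Partition Z Y (Prod X (Size 2)) →
  Partition (λ x → Y x ⊎ Prod X (_≡ t₁) x) Y (Prod X (_≡ t₁)) × Partition Z (λ x → Y x ⊎ Prod X (_≡ t₁) x) (Prod X (_≡ t₂))
prod-pair {Y} {Z} {X} part =
  partition id inj₁ inj₂ (λ { {node _ _} y (x , refl) → apart y (x , refl) })
  , partition (λ z → [ (λ y → inj₁ (inj₁ y)) , divide ]′ (split z)) [ left , back ]′ (λ { {node _ _} (x , refl) → right (x , refl) })
      (λ { {node _ _} (inj₁ y) (x , refl) → apart y (x , refl) ; {node _ _} (inj₂ (_ , refl)) (_ , ()) })
  where
  open Partition part
  divide : ∀ {x} → Prod X (Size 2) x → (Y x ⊎ Prod X (_≡ t₁) x) ⊎ Prod X (_≡ t₂) x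
  divide {node _ _} (x , s) = Sum.map (λ eq → inj₂ (x , eq)) (x ,_) (size≡2 s)
  back : ∀ {x} → Prod X (_≡ t₁) x → Z x
  back {node _ _} (x , refl) = right (x , refl)

-- The inductive step.

record Below (k : ℕ) : Set₁ where
  field
    whole : ∀ d → d < k → d ≢ 2 → Glued (Size d) ∅ ∅
    half  : ∀ m → 2 + m < k → Halves m ∅ ∅

module Climb {F G F' G' : Marks} (nl : No-leave G) {k : ℕ} (below : Below k)
             (top-half : ∀ m → 2 + m ≡ k → Halves m G G') {l : ℕ} (l≤1 : l ≤ 1) where
  open Below below

  From : ℕ → ℕ → Dyck → Set
  From m j _ = m ≤ j

  -- Left parts of size `2 + m` are attached to those of size `1 + m`. The case distinction is on
  -- the size `d` of the right parts, with 0 and 2 exceptional.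
  climb-step : ∀ m d → 2 + m + d ≡ k → Glued (Range l (suc m) k) (Stage F G (From m)) (Marked F' G') →
               Glued (Range l (2 + m) k) (Stage F G (From (suc m))) (Marked F' G')
  climb-step m d eq g = by d eq
    where
    x₃∈ : ∀ {d} t → size t ≡ d → 2 + m + d ≡ k → Range l (suc m) k (x₃ (comb m) t)
    x₃∈ t refl eq = ≤-trans l≤1 (s≤s z≤n) , s≤s (≤-reflexive (size-comb m)) ,
      trans (cong (λ z → suc (z + suc (size t))) (size-comb m)) (trans (cong suc (+-suc m (size t))) eq)
    part : ∀ {d} → 2 + m + d ≡ k → Partition (Range l (2 + m) k) (Range l (suc m) k) (Prod (Size (2 + m)) (Size d))
    part = range-step (≤-trans l≤1 (s≤s z≤n))
    lower : ∀ {d} → 2 + m + suc d ≡ k → 2 + m < k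
    lower {d} eq = ≤-trans (s≤s (m≤m+n (2 + m) d)) (≤-reflexive (trans (sym (+-suc (2 + m) d)) eq))
    lower' : ∀ {d} → 2 + m + d ≡ k → d < k
    lower' {d} eq = ≤-trans (s≤s (m≤n+m d (1 + m))) (≤-reflexive eq)
    generic : ∀ d → 2 + m + suc d ≡ k → suc d ≢ 2 → Glued (Range l (2 + m) k) (Stage F G (From (suc m))) (Marked F' G')
    generic d eq d≢2 = attach nl m (comb (suc d)) g (x₃∈ (comb (suc d)) (size-comb (suc d)) eq) ≤-refl <⇒≤ (<-irrefl refl)
      (half m (lower eq)) (whole (suc d) (lower' eq) d≢2) (size-comb (suc d)) (λ ()) (part eq)
    by : ∀ d → 2 + m + d ≡ k → Glued (Range l (2 + m) k) (Stage F G (From (suc m))) (Marked F' G')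
    -- The right part is `leaf` and the left part has full size `k`: here the second family of
    -- choices enters, through `top-half`.
    by 0 eq = attach nl m leaf g (x₃∈ leaf refl eq) ≤-refl <⇒≤ (<-irrefl refl)
      (top-half m (trans (sym (+-comm (2 + m) 0)) eq)) ⟨0⟩ refl (λ _ → refl , (λ _ _ → id) , (λ _ _ → id)) (part eq)
    by 1 eq = generic 0 eq (λ ())
    by (suc (suc (suc d))) eq = generic (2 + d) eq (λ ())
    by 2 eq = attach nl m t₂ {Q = Q₁} {Q' = From (suc m)}
        (attach nl m t₁ {Q' = Q₁} g (x₃∈ t₁ refl eq) ≤-refl (λ { (inj₁ m<j) → <⇒≤ m<j ; (inj₂ (refl , _)) → ≤-refl })
          (λ { (inj₁ m<m) → <-irrefl refl m<m ; (inj₂ (_ , ≢)) → ≢ refl })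
          (half m (lower eq)) (only t₁) refl (λ ()) (proj₁ (prod-pair (part eq))))
        (inj₁ (x₃∈ t₂ refl eq)) (inj₂ (refl , λ ())) inj₁ (<-irrefl refl)
        (half m (lower eq)) (only t₂) refl (λ ()) (proj₂ (prod-pair (part eq)))
      where
      -- Between the two attachments, the connecting slot for `comb (1 + m)` is spent at the right
      -- part `node leaf t₁` only.
      Q₁ : ℕ → Dyck → Set
      Q₁ j v = m < j ⊎ (j ≡ m × v ≢ node leaf t₁)

  climb : ∀ d m → suc m + d ≡ k → Glued (Range l (suc m) k) (Stage F G (From m)) (Marked F' G') →
          Glued (Range l k k) (Stage F G (λ _ _ → ⊥)) (Marked F' G')
  climb zero m eq g with trans (sym (+-comm (suc m) 0)) eq
  ... | refl = weaken id id (λ { _ _ _ (mark x) → mark x ; _ _ _ hook → hook }) (λ _ _ _ → id) g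
  climb (suc d) m eq g = climb d (suc m) eq' (climb-step m d eq' g)
    where
    eq' : 2 + m + d ≡ k
    eq' = trans (cong suc (sym (+-suc m d))) eq

partition-cong : ∀ {Z X X' Y} → (∀ {x} → X x → X' x) → (∀ {x} → X' x → X x) → Partition Z X Y → Partition Z X' Y
partition-cong i j part = partition (λ z → Sum.map₁ i (split z)) (λ x → left (j x)) right (λ x → apart (j x))
  where open Partition part

module Next {F G F' G' : Marks} (nl : No-leave G) (n : ℕ) (below : Below (4 + n))
            (whole-k : Glued (Size (4 + n)) F F') (half-k : Halves (2 + n) G G') where
  open Below below

  k : ℕ
  k = 4 + n

  top-half : ∀ m → 2 + m ≡ k → Halves m G G'
  top-half m refl = half-k

  C₀ C₁ : Pred
  C₀ = Prod (_≡ leaf) (Size k)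
  C₁ = Prod (_≡ o) (Size (3 + n))

  class₀ : Glued C₀ (LiftA F) (LiftM F')
  class₀ = lift leaf whole-k

  class₁ : Glued C₁ (LiftA ∅) (LiftM ∅)
  class₁ = lift o (whole (3 + n) ≤-refl (λ ()))

  range₁ : ∀ {x} → C₁ x → Range 1 1 k x
  range₁ {node _ _} (refl , v≡) = ≤-refl , ≤-refl , cong suc v≡

  range₁⁻ : ∀ {x} → Range 1 1 k x → C₁ x
  range₁⁻ {node u v} (1≤u , u≤1 , eq) with size≡1 {u} (≤-antisym u≤1 1≤u)
  ... | refl = refl , suc-injective eq

  range₀₁ : ∀ {x} → Range 0 1 k x → C₀ x ⊎ C₁ x
  range₀₁ {node leaf v} (_ , _ , eq)              = inj₁ (refl , eq)
  range₀₁ {node (node _ _) v} (_ , s≤s u≤ , eq)   = inj₂ (range₁⁻ (s≤s z≤n , s≤s u≤ , eq))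

  range₀₁⁻ : ∀ {x} → C₀ x ⊎ C₁ x → Range 0 1 k x
  range₀₁⁻ {node _ _} (inj₁ (refl , eq)) = z≤n , z≤n , eq
  range₀₁⁻ {node _ _} (inj₂ (refl , eq)) = z≤n , ≤-refl , cong suc eq

  part₂ : Partition (Range 0 2 k) (λ x → C₀ x ⊎ C₁ x) (Prod (Size 2) (Size (2 + n)))
  part₂ = partition-cong range₀₁ range₀₁⁻ (range-step {d = 2 + n} z≤n refl)

  module Climb₀ = Climb {F} {G} {F'} {G'} nl below top-half {0} z≤n
  module Climb₁ = Climb {F} {G} {F'} {G'} nl below top-half {1} ≤-refl

  -- For `n = 0` the right parts facing left parts of size 2 have size 2 themselves and no pattern:
  -- the 8-cycle takes `t₁`, a 6-cycle then adds `t₂`.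
  two-classes : ∀ n → Glued (Prod (_≡ leaf) (Size (4 + n))) (LiftA F) (LiftM F') → Glued (Prod (_≡ o) (Size (3 + n))) (LiftA ∅) (LiftM ∅) →
    Halves 0 ∅ ∅ → (2 + n ≢ 2 → Glued (Size (2 + n)) ∅ ∅) →
    Partition (Range 0 2 (4 + n)) (λ x → Prod (_≡ leaf) (Size (4 + n)) x ⊎ Prod (_≡ o) (Size (3 + n)) x) (Prod (Size 2) (Size (2 + n))) →
    Glued (Range 0 2 (4 + n)) (Stage F G (Climb₀.From 1)) (Marked F' G')
  two-classes zero c₀ c₁ h _ part = attach nl 0 t₂ {Q = Climb₀.From 0}
    (attach₄ nl t₁ c₀ c₁ refl refl h (only t₁) refl (λ ()) (proj₁ (prod-pair part)))
    (inj₁ (inj₂ (refl , refl))) z≤n (λ _ → z≤n) (λ ()) h (only t₂) refl (λ ()) (proj₂ (prod-pair part))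
  two-classes (suc n) c₀ c₁ h w part =
    attach₄ nl (comb (3 + n)) c₀ c₁ (size-comb (3 + n)) (cong (2 +_) (size-comb (3 + n))) h (w λ ()) (size-comb (3 + n)) (λ ()) part

  whole-next : Glued (Size (suc k)) (Marked F G) (Marked F' G')
  whole-next = weaken (λ { {node u v} (_ , _ , eq) → cong suc eq })
    (λ { {node u v} eq → z≤n , ≤-trans (m≤m+n (size u) (size v)) (≤-reflexive (suc-injective eq)) , suc-injective eq })
    (λ _ _ _ → mark) (λ _ _ _ → id)
    (Climb₀.climb (2 + n) 1 refl
      (two-classes n class₀ class₁ (half 0 (s≤s (s≤s (s≤s z≤n)))) (whole (2 + n) (s≤s (s≤s (s≤s (n≤1+n n))))) part₂))

  -- Leaving out the 8-cycle and climbing from `class₁` alone yields all words except the 10v; these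
  -- form the other half.
  half-next : Halves (3 + n) (Marked F G) (Marked F' G')
  half-next = record
    { PA = C₀
    ; PB = Range 1 k k
    ; gA = weaken id id
        (λ { _ _ _ (mark (base m)) → m ; _ _ (_ , ()) (mark (top _)) ; _ _ _ (spine _) → tt ; _ _ _ hook → tt })
        (λ { _ _ _ (base m) → m ; _ _ (_ , ()) (top _) })
        class₀
    ; gB = weaken id id
        (λ { _ _ _ (mark m) → mark m ; _ _ (() , _) (spine _) ; _ _ _ hook → hook })
        (λ _ _ _ → id)
        (Climb₁.climb (3 + n) 0 refl (weaken range₁ range₁⁻
          (λ { _ _ (() , _) (mark (base _)) ; _ _ (_ , ()) (mark (top _)) ; _ _ _ (step j _) → tt ; _ _ _ hook → tt })
          (λ { _ _ (() , _) (base _) ; _ _ (_ , ()) (top _) })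
          class₁))
    ; halves = partition
        (λ { {node leaf v} eq → inj₁ (refl , suc-injective eq)
           ; {node u@(node _ _) v} eq → inj₂ (s≤s z≤n , ≤-trans (m≤m+n (size u) (size v)) (≤-reflexive (suc-injective eq)) , suc-injective eq) })
        (λ { {node _ _} (refl , eq) → cong suc eq })
        (λ { {node _ _} (_ , _ , eq) → cong suc eq })
        (λ { {node _ _} (refl , _) (() , _) })
    ; combA = refl , size-comb (4 + n)
    ; hookB = ≤-refl , s≤s z≤n , cong suc (size-comb (3 + n))
    }

-- Patterns for words of size at most four.

infixr 1 _∪_
_∪_ : Pred → Pred → Pred
(X ∪ Y) x = X x ⊎ Y x

union : ∀ {X Y : Pred} → (∀ {x} → X x → Y x → ⊥) → Partition (X ∪ Y) X Y
union = partition id inj₁ inj₂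

solo : ∀ {x} (e : Slot x) {A M} → (∀ f → A x f → ¬ Same-slot e x f) → (∀ f → M x f → Same-slot e x f) →
       Chain (lo e) (hi e) (_≡ x) A M
solo e α μ = cut-open e (single _) refl tt (λ { _ f refl A → tt , α f A }) (λ { _ f refl M → inj₂ (μ f M) })

whole₁ : Glued (Size 1) ∅ ∅
whole₁ = weaken (λ { refl → refl }) size≡1 (λ _ _ _ ()) (λ _ _ _ ()) (single o)

half₂ : Halves 0 ∅ ∅
half₂ = record
  { PA = _≡ t₂ ; PB = _≡ t₁
  ; gA = weaken id id (λ _ _ _ _ → tt) (λ _ _ _ ()) (single t₂)
  ; gB = weaken id id (λ _ _ _ _ → tt) (λ _ _ _ ()) (single t₁)
  ; halves = partition (λ s → Sum.swap (size≡2 s)) (λ { refl → refl }) (λ { refl → refl }) (λ { refl () })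
  ; combA = refl ; hookB = refl
  }

-- 111000, 110100, 110010, 101100 and 101010
w₁ w₂ w₃ w₄ w₅ : Dyck
w₁ = x₁ leaf leaf
w₂ = x₂ leaf leaf
w₃ = x₃ leaf leaf
w₄ = y₂ leaf
w₅ = comb 3

size≡3 : ∀ {x} → Size 3 x → (x ≡ w₁ ⊎ x ≡ w₃) ⊎ (x ≡ w₄ ⊎ x ≡ w₂) ⊎ x ≡ w₅
size≡3 {node leaf v} eq with size≡2 {v} (suc-injective eq)
... | inj₁ refl = inj₂ (inj₁ (inj₁ refl))
... | inj₂ refl = inj₂ (inj₂ refl)
size≡3 {node u@(node leaf leaf) v} eq with size≡1 {v} (suc-injective (suc-injective eq))
... | refl = inj₁ (inj₂ refl)
size≡3 {node u@(node leaf (node leaf leaf)) leaf} eq = inj₂ (inj₁ (inj₂ refl))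
size≡3 {node u@(node (node leaf leaf) leaf) leaf} eq = inj₁ (inj₁ refl)
size≡3 {node (node leaf (node leaf leaf)) (node _ _)} ()
size≡3 {node (node leaf (node leaf (node _ _))) _} ()
size≡3 {node (node leaf (node (node _ _) _)) _} ()
size≡3 {node (node (node leaf leaf) leaf) (node _ _)} ()
size≡3 {node (node (node leaf leaf) (node _ _)) _} ()
size≡3 {node (node (node leaf (node _ _)) _) _} ()
size≡3 {node (node (node (node _ _) _) _) _} ()

half₃ : Halves 1 ∅ ∅
half₃ = record
  { PA = _≡ w₅ ; PB = ((_≡ w₁ ∪ _≡ w₃) ∪ _≡ w₄) ∪ _≡ w₂
  ; gA = weaken id id (λ _ _ _ _ → tt) (λ _ _ _ ()) (single w₅)
  ; gB = octagon leaf
      (solo (inU leave) (λ { _ hook () }) (λ _ ()))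
      (solo (inU leave) (λ { _ hook () }) (λ _ ()))
      (solo enter (avail₄ refl) (λ _ ()))
      (solo enter (λ { _ hook () }) (λ _ ()))
      (union λ { refl () })
      (union λ { (inj₁ refl) () ; (inj₂ refl) () })
      (union λ { (inj₁ (inj₁ refl)) () ; (inj₁ (inj₂ refl)) () ; (inj₂ refl) () })
  ; halves = partition
      (λ s → case size≡3 s of λ { (inj₁ p) → inj₂ (inj₁ (inj₁ p)) ; (inj₂ (inj₁ (inj₁ p))) → inj₂ (inj₁ (inj₂ p))
                                ; (inj₂ (inj₁ (inj₂ p))) → inj₂ (inj₂ p) ; (inj₂ (inj₂ p)) → inj₁ p })
      (λ { refl → refl })
      (λ { (inj₁ (inj₁ (inj₁ refl))) → refl ; (inj₁ (inj₁ (inj₂ refl))) → refl ; (inj₁ (inj₂ refl)) → refl ; (inj₂ refl) → refl })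
      (λ { refl (inj₁ (inj₁ (inj₁ ()))) ; refl (inj₁ (inj₁ (inj₂ ()))) ; refl (inj₁ (inj₂ ())) ; refl (inj₂ ()) })
  ; combA = refl
  ; hookB = inj₁ (inj₁ (inj₂ refl))
  }
  where
  avail₄ : ∀ {x} → x ≡ w₄ → ∀ f → Keep ∅ x f → ¬ Same-slot {w₄} enter x f
  avail₄ eq _ (spine zero) s    = case cong right-part eq of λ ()
  avail₄ eq _ (spine (suc n)) s = case cong (λ x → left-part (right-part x)) eq of λ ()
  avail₄ eq _ hook ()

-- w₁ is 111000; its slot is used by the first of the two patterns below only.
Marked₃ : Bool → Bool → Marks
Marked₃ β γ x e = β ≡ γ × Same-slot {w₁} (inU leave) x e

-- The elementary binary choice: two 6-cycles merge the same three words. The first opens `w₁` at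
-- `inU leave`, the second at `inU (inU enter)`, and both spare the slot `enter` of `w₁`.
triple : ∀ β → Glued ((_≡ w₁ ∪ _≡ w₃) ∪ _≡ w₂) (λ x e → Same-slot {w₁} enter x e ⊎ Marked₃ β false x e) (Marked₃ β true)
triple true = hexagon leaf leaf
  (solo (inU leave) (λ { _ (inj₁ same) () ; _ (inj₂ (() , _)) }) (λ { _ (_ , same) → same }))
  (solo (inU enter) (λ { _ (inj₁ ()) ; _ (inj₂ (() , _)) }) (λ { _ (_ , ()) }))
  (solo enter (λ { _ (inj₁ ()) ; _ (inj₂ (() , _)) }) (λ { _ (_ , ()) }))
  (union λ { refl () })
  (union λ { (inj₁ refl) () ; (inj₂ refl) () })
triple false = close (link
    (solo (inU (inU enter)) (λ { _ (inj₁ same) () ; _ (inj₂ (_ , same)) () }) (λ { _ (() , _) })) here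
    (solo (inV leave) (λ { _ (inj₁ ()) ; _ (inj₂ (_ , ())) }) (λ { _ (() , _) }))
    (union λ { refl () })) (there (there (there here)))
  (solo leave (λ { _ (inj₁ ()) ; _ (inj₂ (_ , ())) }) (λ { _ (() , _) })) (there (there (there (there here))))
  (union λ { (inj₁ refl) () ; (inj₂ refl) () })

-- One more 6-cycle meets `w₄`, `w₅` and the slot `enter` of `w₁` spared by either version of
-- `triple`.
whole₃ : ∀ β → Glued (Size 3) (Marked₃ β false) (Marked₃ β true)
whole₃ β = close (link
    (solo (inV (inU leave)) (λ { _ (_ , ()) }) (λ { _ (_ , ()) })) (there (there (there (there (there here)))))
    (solo leave (λ { _ (_ , ()) }) (λ { _ (_ , ()) }))
    (union λ { refl () })) (there (there (there (there here))))
  (cut-open enter (triple β) (inj₁ (inj₁ refl)) (inj₁ same)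
    (λ { _ _ _ (β≡ , same) → inj₂ (β≡ , same) , λ () }) (λ _ _ _ → inj₁)) here
  (partition
    (λ s → case size≡3 s of λ { (inj₁ p) → inj₂ (inj₁ p) ; (inj₂ (inj₁ (inj₁ p))) → inj₁ (inj₁ p)
                              ; (inj₂ (inj₁ (inj₂ p))) → inj₂ (inj₂ p) ; (inj₂ (inj₂ p)) → inj₁ (inj₂ p) })
    (λ { (inj₁ refl) → refl ; (inj₂ refl) → refl })
    (λ { (inj₁ (inj₁ refl)) → refl ; (inj₁ (inj₂ refl)) → refl ; (inj₂ refl) → refl })
    (λ { (inj₁ refl) (inj₁ (inj₁ ())) ; (inj₁ refl) (inj₁ (inj₂ ())) ; (inj₁ refl) (inj₂ ())
       ; (inj₂ refl) (inj₁ (inj₁ ())) ; (inj₂ refl) (inj₁ (inj₂ ())) ; (inj₂ refl) (inj₂ ()) }))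

-- 11110000, 11101000, 11100100, 11001100 and 11011000
r₁ r₂ r₃ q₂ q₃ : Dyck
r₁ = node w₁ leaf
r₂ = node w₂ leaf
r₃ = node w₄ leaf
q₂ = node o t₁
q₃ = x₁ o leaf

data Hooked {x} (e : Slot x) : Marks where
  mark : Hooked e x e
  hook : ∀ {u v} → Hooked e (node u v) leave

-- Size 4 is done by hand: the general step would start from the words `node o v` with `v` of size
-- 2, for which there is no pattern. The nine words not of the form 10v are merged by four 6-cycles
-- in succession, each group keeping the slot that the next one opens.
group₁ : Glued ((_≡ r₁ ∪ _≡ r₂) ∪ _≡ r₃) (Hooked {r₂} (inU (inU (inV enter)))) ∅
group₁ = close (link
    (solo (inU (inU (inU leave))) (λ { _ hook () }) (λ _ ())) (there (there (there (there (there here)))))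
    (solo (inU enter) (λ { _ mark () ; _ hook () }) (λ _ ()))
    (union λ { refl () })) (there (there (there (there here))))
  (solo (inU enter) (λ { _ hook () }) (λ _ ())) (there here)
  (union λ { (inj₁ refl) () ; (inj₂ refl) () })

group₂ : Glued ((((_≡ r₁ ∪ _≡ r₂) ∪ _≡ r₃) ∪ _≡ q₂) ∪ _≡ q₃) (Hooked {q₃} (inU leave)) ∅
group₂ = close (link
    (cut-open (inU (inU (inV enter))) group₁ (inj₁ (inj₂ refl)) mark
      (λ { _ _ (inj₁ (inj₁ ())) mark ; _ _ (inj₁ (inj₂ ())) mark ; _ _ (inj₂ ()) mark ; _ _ _ hook → hook , λ () }) (λ _ _ _ → inj₁)) (there (there (there (there (there (there (there here)))))))
    (solo (inU enter) (λ { _ hook () }) (λ _ ()))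
    (union λ { (inj₁ (inj₁ refl)) () ; (inj₁ (inj₂ refl)) () ; (inj₂ refl) () })) (there (there (there (there (there here)))))
  (solo enter (λ { _ mark () ; _ hook () }) (λ _ ())) (there here)
  (union λ { (inj₁ (inj₁ (inj₁ refl))) () ; (inj₁ (inj₁ (inj₂ refl))) () ; (inj₁ (inj₂ refl)) () ; (inj₂ refl) () })

Group₂ Group₃ : Pred
Group₂ = (((_≡ r₁ ∪ _≡ r₂) ∪ _≡ r₃) ∪ _≡ q₂) ∪ _≡ q₃
Group₃ = (Group₂ ∪ _≡ x₃ o leaf) ∪ _≡ x₂ o leaf

group₃ : Glued Group₃ (Hooked {x₂ leaf o} enter) ∅
group₃ = hexagon o leaf
  (cut-open (inU leave) group₂ (inj₂ refl) mark
    (λ { _ _ (inj₁ (inj₁ (inj₁ (inj₁ ())))) mark ; _ _ (inj₁ (inj₁ (inj₁ (inj₂ ())))) mark ; _ _ (inj₁ (inj₁ (inj₂ ()))) mark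
       ; _ _ (inj₁ (inj₂ ())) mark ; _ _ (inj₂ ()) mark ; _ _ _ hook → hook , λ () }) (λ _ _ _ → inj₁))
  (solo (inU enter) (λ { _ mark () ; _ hook () }) (λ _ ()))
  (solo enter (λ { _ hook () }) (λ _ ()))
  (union λ { (inj₁ (inj₁ (inj₁ (inj₁ refl)))) () ; (inj₁ (inj₁ (inj₁ (inj₂ refl)))) () ; (inj₁ (inj₁ (inj₂ refl))) ()
            ; (inj₁ (inj₂ refl)) () ; (inj₂ refl) () })
  (union λ { (inj₁ (inj₁ (inj₁ (inj₁ (inj₁ refl))))) () ; (inj₁ (inj₁ (inj₁ (inj₁ (inj₂ refl))))) () ; (inj₁ (inj₁ (inj₁ (inj₂ refl)))) ()
            ; (inj₁ (inj₁ (inj₂ refl))) () ; (inj₁ (inj₂ refl)) () ; (inj₂ refl) () })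

B₄ : Pred
B₄ = (_≡ x₁ leaf o ∪ _≡ x₃ leaf o) ∪ Group₃

size≡4 : ∀ {x} → Size 4 x → Prod (_≡ leaf) (Size 3) x ⊎ B₄ x
size≡4 {node u v} eq = by (size u) refl (suc-injective eq)
  where
  by : ∀ n → size u ≡ n → n + size v ≡ 3 → Prod (_≡ leaf) (Size 3) (node u v) ⊎ B₄ (node u v)
  by 0 u≡ v≡ = inj₁ (size≡0 u≡ , v≡)
  by 1 u≡ v≡ with size≡1 {u} u≡ | size≡2 {v} (suc-injective v≡)
  ... | refl | inj₁ refl = inj₂ (inj₂ (inj₁ (inj₁ (inj₁ (inj₂ refl)))))
  ... | refl | inj₂ refl = inj₂ (inj₁ (inj₂ refl))
  by 2 u≡ v≡ with size≡2 {u} u≡ | size≡1 {v} (suc-injective (suc-injective v≡))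
  ... | inj₁ refl | refl = inj₂ (inj₁ (inj₁ refl))
  ... | inj₂ refl | refl = inj₂ (inj₂ (inj₁ (inj₂ refl)))
  by 3 u≡ v≡ with size≡3 {u} u≡ | size≡0 {v} (suc-injective (suc-injective (suc-injective v≡)))
  ... | inj₁ (inj₁ refl)        | refl = inj₂ (inj₂ (inj₁ (inj₁ (inj₁ (inj₁ (inj₁ (inj₁ refl)))))))
  ... | inj₁ (inj₂ refl)        | refl = inj₂ (inj₂ (inj₁ (inj₁ (inj₂ refl))))
  ... | inj₂ (inj₁ (inj₁ refl)) | refl = inj₂ (inj₂ (inj₁ (inj₁ (inj₁ (inj₁ (inj₂ refl))))))
  ... | inj₂ (inj₁ (inj₂ refl)) | refl = inj₂ (inj₂ (inj₁ (inj₁ (inj₁ (inj₁ (inj₁ (inj₂ refl)))))))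
  ... | inj₂ (inj₂ refl)        | refl = inj₂ (inj₂ (inj₂ refl))

group₃-elim : ∀ {P : Pred} → P r₁ → P r₂ → P r₃ → P q₂ → P q₃ → P (x₃ o leaf) → P (x₂ o leaf) → ∀ {x} → Group₃ x → P x
group₃-elim p₁ p₂ p₃ p₄ p₅ p₆ p₇ = λ
  { (inj₁ (inj₁ (inj₁ (inj₁ (inj₁ (inj₁ refl)))))) → p₁ ; (inj₁ (inj₁ (inj₁ (inj₁ (inj₁ (inj₂ refl)))))) → p₂
  ; (inj₁ (inj₁ (inj₁ (inj₁ (inj₂ refl))))) → p₃ ; (inj₁ (inj₁ (inj₁ (inj₂ refl)))) → p₄ ; (inj₁ (inj₁ (inj₂ refl))) → p₅
  ; (inj₁ (inj₂ refl)) → p₆ ; (inj₂ refl) → p₇ }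

Branching : Pred
Branching x = left-part x ≢ leaf

group₃-branching : ∀ {x} → Group₃ x → Branching x
group₃-branching = group₃-elim {Branching} (λ ()) (λ ()) (λ ()) (λ ()) (λ ()) (λ ()) (λ ())

class₄ : ∀ β → Glued (Prod (_≡ leaf) (Size 3)) (LiftA (Marked₃ β false)) (LiftM (Marked₃ β true))
class₄ β = lift leaf (whole₃ β)

half₄ : ∀ β → Halves 2 (Marked (Marked₃ β false) ∅) (Marked (Marked₃ β true) ∅)
half₄ β = record
  { PA = Prod (_≡ leaf) (Size 3)
  ; PB = B₄
  ; gA = weaken id id
      (λ { _ _ _ (mark (base m)) → m ; _ _ _ (mark (top ())) ; _ _ _ (spine _) → tt ; _ _ _ hook → tt })
      (λ { _ _ _ (base m) → m ; _ _ _ (top ()) })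
      (class₄ β)
  ; gB = hexagon leaf o
      (solo (inU leave) (λ { _ (mark ()) ; _ hook () }) (λ _ ()))
      (solo (inU enter) (λ { _ (mark ()) ; _ hook () }) (λ _ ()))
      -- `x₂ leaf o` and `x₃ o leaf` are the same word 11010010, so `group₃` contains it.
      (cut-open enter group₃ (inj₁ (inj₂ refl)) mark α μ)
      (union λ { refl () })
      (union λ { (inj₁ refl) g → group₃-elim {λ x → x₁ leaf o ≢ x} (λ ()) (λ ()) (λ ()) (λ ()) (λ ()) (λ ()) (λ ()) g refl
               ; (inj₂ refl) g → group₃-elim {λ x → x₃ leaf o ≢ x} (λ ()) (λ ()) (λ ()) (λ ()) (λ ()) (λ ()) (λ ()) g refl })
  ; halves = partition size≡4 (λ { {node _ _} (refl , v≡) → cong suc v≡ })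
      (λ { (inj₁ (inj₁ refl)) → refl ; (inj₁ (inj₂ refl)) → refl ; (inj₂ g) → group₃-elim {Size 4} refl refl refl refl refl refl refl g })
      (λ { {node _ _} (refl , _) (inj₁ (inj₁ ())) ; {node _ _} (refl , _) (inj₁ (inj₂ ())) ; {node _ _} (refl , _) (inj₂ g) → group₃-branching g refl })
  ; combA = refl , refl
  ; hookB = inj₁ (inj₂ refl)
  }
  where
  α : ∀ y f → Group₃ y → Keep (Marked (Marked₃ β false) ∅) y f → Hooked {x₂ leaf o} enter y f × ¬ Same-slot {x₂ leaf o} enter y f
  α _ _ g (mark (base _)) = ⊥-elim (group₃-branching g refl)
  α _ _ g (spine _)       = ⊥-elim (group₃-branching g refl)
  α _ _ g hook            = hook , λ ()
  μ : ∀ y f → Group₃ y → Marked (Marked₃ β true) ∅ y f → ⊥ ⊎ Same-slot {x₂ leaf o} enter y f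
  μ _ _ g (base _) = ⊥-elim (group₃-branching g refl)

-- The last 6-cycle of `half₄` is replaced by an 8-cycle through the same three pieces and `class₄`;
-- the words `y₁ o` and `x₃ leaf o` coincide.
whole₄ : ∀ β → Glued (Size 4) (Marked (Marked₃ β false) ∅) (Marked (Marked₃ β true) ∅)
whole₄ β = octagon o
  (solo (inU leave) (λ { _ () }) (λ _ ()))
  (solo (inU leave) (λ { _ () }) (λ _ ()))
  (cut-open {x = y₂ o} enter (class₄ β) (refl , refl) tt (λ { _ _ _ (base m) → m , λ () }) (λ { _ _ _ (base m) → inj₁ m }))
  (cut-open enter group₃ (inj₁ (inj₂ refl)) mark
    (λ { _ _ g (base _) → ⊥-elim (group₃-branching g refl) }) (λ { _ _ g (base _) → ⊥-elim (group₃-branching g refl) }))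
  (union λ { refl () })
  (union λ { {node _ _} (inj₁ refl) (() , _) ; {node _ _} (inj₂ refl) (() , _) })
  (partition
    (λ s → case size≡4 s of λ { (inj₁ p) → inj₁ (inj₂ p) ; (inj₂ (inj₁ p)) → inj₁ (inj₁ p) ; (inj₂ (inj₂ g)) → inj₂ g })
    (λ { (inj₁ p) → right (inj₁ p) ; (inj₂ p) → left p })
    (λ g → right (inj₂ g))
    (λ { (inj₁ p) g → part₁ p g ; {node _ _} (inj₂ (refl , _)) g → group₃-branching g refl }))
  where
  open Halves (half₄ β)
  open Partition halves
  part₁ : ∀ {x} → x ≡ x₁ leaf o ⊎ x ≡ x₃ leaf o → Group₃ x → ⊥
  part₁ (inj₁ refl) g = group₃-elim {λ x → x₁ leaf o ≢ x} (λ ()) (λ ()) (λ ()) (λ ()) (λ ()) (λ ()) (λ ()) g refl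
  part₁ (inj₂ refl) g = group₃-elim {λ x → x₃ leaf o ≢ x} (λ ()) (λ ()) (λ ()) (λ ()) (λ ()) (λ ()) (λ ()) g refl

-- The recursion

-- A complete binary tree holding 2^n bits, the free choices at size `4 + n`.
Bits : ℕ → Set
Bits zero    = Bool
Bits (suc n) = Bits n × Bits n

constant : ∀ n → Bool → Bits n
constant zero    β = β
constant (suc n) β = constant n β , constant n β

-- The last argument is `false` for the slots left available and `true` for those used up; each bit
-- puts its slot into exactly one of the two families.
Marking : ∀ n → Bits n → Bool → Marks
Marking zero    β       γ = Marked (Marked₃ β γ) ∅
Marking (suc n) (c , d) γ = Marked (Marking n c γ) (Marking n d γ)

marking-no-leave : ∀ n c γ → No-leave (Marking n c γ)
marking-no-leave zero    c γ ()
marking-no-leave (suc n) c γ ()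

forget : ∀ {X A M} → Glued X A M → Glued X ∅ ∅
forget = weaken id id (λ _ _ _ ()) (λ _ _ _ ())

forget-half : ∀ {m A M} → Halves m A M → Halves m ∅ ∅
forget-half h = record
  { PA = PA ; PB = PB ; halves = halves ; combA = combA ; hookB = hookB
  ; gA = weaken id id (λ { _ _ _ (spine n) → spine n ; _ _ _ hook → hook }) (λ _ _ _ ()) gA
  ; gB = weaken id id (λ { _ _ _ (spine n) → spine n ; _ _ _ hook → hook }) (λ _ _ _ ()) gB }
  where open Halves h

record Stratum (n : ℕ) : Set₁ where
  field
    below : Below (4 + n)
    whole : ∀ c → Glued (Size (4 + n)) (Marking n c false) (Marking n c true)
    half  : ∀ c → Halves (2 + n) (Marking n c false) (Marking n c true)

stratum : ∀ n → Stratum n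
stratum zero = record
  { below = record
    { whole = λ { 0 _ _ → ⟨0⟩ ; 1 _ _ → whole₁ ; 2 _ 2≢2 → ⊥-elim (2≢2 refl) ; 3 _ _ → forget (whole₃ true)
                ; (suc (suc (suc (suc _)))) (s≤s (s≤s (s≤s (s≤s ())))) _ }
    ; half  = λ { 0 _ → half₂ ; 1 _ → half₃ ; (suc (suc _)) (s≤s (s≤s (s≤s (s≤s ())))) } }
  ; whole = whole₄
  ; half  = half₄ }
stratum (suc n) = record
  { below = record { whole = below-whole ; half = below-half }
  ; whole = λ { (c , d) → Next.whole-next (marking-no-leave n d false) n below (whole c) (half d) }
  ; half  = λ { (c , d) → Next.half-next (marking-no-leave n d false) n below (whole c) (half d) } }
  where
  open Stratum (stratum n)
  below-whole : ∀ d → d < 5 + n → d ≢ 2 → Glued (Size d) ∅ ∅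
  below-whole d (s≤s d≤) d≢2 with m≤n⇒m<n∨m≡n d≤
  ... | inj₁ d<   = Below.whole below d d< d≢2
  -- Any choice would serve, since the marks are forgotten.
  ... | inj₂ refl = forget (whole (constant n true))
  below-half : ∀ m → 2 + m < 5 + n → Halves m ∅ ∅
  below-half m (s≤s m≤) with m≤n⇒m<n∨m≡n m≤
  ... | inj₁ m<   = Below.half below m m<
  ... | inj₂ refl = forget-half (half (constant n true))

-- Hamilton cycles of the odd graph

-- Lists are padded with false or truncated to length n.
toVec : ∀ n → Str → Vec Bool n
toVec zero    _       = []
toVec (suc n) []      = false ∷ toVec n []
toVec (suc n) (c ∷ s) = c ∷ toVec n s

toList-toVec : ∀ s → toList (toVec (length s) s) ≡ s
toList-toVec []      = refl
toList-toVec (c ∷ s) = cong (c ∷_) (toList-toVec s)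

toVec-toList : ∀ {n} (v : Vec Bool n) → toVec n (toList v) ≡ v
toVec-toList []      = refl
toVec-toList (c ∷ v) = cong (c ∷_) (toVec-toList v)

toVec-size : ∀ s → ∣ toVec (length s) s ∣ ≡ ones s
toVec-size []          = refl
toVec-size (true ∷ s)  = cong suc (toVec-size s)
toVec-size (false ∷ s) = toVec-size s

toList-weights : ∀ {n} (v : Vec Bool n) → ones (toList v) ≡ ∣ v ∣ × ones (toList v) + zeros (toList v) ≡ n
toList-weights []          = refl , refl
toList-weights (true ∷ v)  with toList-weights v
... | o≡ , l≡ = cong suc o≡ , cong suc l≡
toList-weights (false ∷ v) with toList-weights v
... | o≡ , l≡ = o≡ , trans (+-suc (ones (toList v)) _) (cong suc l≡)

data Disjoint : Str → Str → Set where
  []  : Disjoint [] []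
  _∷_ : ∀ {c d s t} → c ∧ d ≡ false → Disjoint s t → Disjoint (c ∷ s) (d ∷ t)

disjoint-not : ∀ s → Disjoint s (map not s)
disjoint-not []          = []
disjoint-not (true ∷ s)  = refl ∷ disjoint-not s
disjoint-not (false ∷ s) = refl ∷ disjoint-not s

disjoint-sym : ∀ {s t} → Disjoint s t → Disjoint t s
disjoint-sym []                       = []
disjoint-sym (_∷_ {false} {false} _ d) = refl ∷ disjoint-sym d
disjoint-sym (_∷_ {false} {true}  _ d) = refl ∷ disjoint-sym d
disjoint-sym (_∷_ {true}  {false} _ d) = refl ∷ disjoint-sym d

disjoint-⋖ : ∀ {s t} → s ⋖ t → Disjoint s (map not t)
disjoint-⋖ (here {s})          = refl ∷ disjoint-not s
disjoint-⋖ (there {true} f)    = refl ∷ disjoint-⋖ f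
disjoint-⋖ (there {false} f)   = refl ∷ disjoint-⋖ f

toVec-disjoint : ∀ n {s t} → Disjoint s t → toVec n s ∩ toVec n t ≡ Subset.⊥
toVec-disjoint zero    d        = refl
toVec-disjoint (suc n) []       = cong (false ∷_) (toVec-disjoint n [])
toVec-disjoint (suc n) (c≡ ∷ d) = cong₂ _∷_ c≡ (toVec-disjoint n d)

encode : Vertex → Str
encode (false , s) = false ∷ s
encode (true  , s) = true ∷ map not s

encode-injective : ∀ p q → encode p ≡ encode q → p ≡ q
encode-injective (false , s) (false , t) refl = refl
encode-injective (true  , s) (true  , t) eq   =
  cong (true ,_) (trans (sym (map-not-not s)) (trans (cong (λ { [] → [] ; (_ ∷ l) → map not l }) eq) (map-not-not t)))

encode-adj : ∀ {p q} → Adj p q → Disjoint (encode p) (encode q)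
encode-adj (flips (up f))   = refl ∷ disjoint-⋖ f
encode-adj (flips (down f)) = refl ∷ disjoint-sym (disjoint-⋖ f)
encode-adj (cross s)        = refl ∷ disjoint-not s
encode-adj (cross′ s)       = refl ∷ disjoint-sym (disjoint-not s)

-- Walks and the cyclic pairs of a list.

module _ {A : Set} where

  -- The closing entry `z` is independent of the head, so that the induction can drop the head.
  zip⁻ : ∀ {a b x y z : A} {p} → Walk a b (a ∷ p) → (x , y) ∈ zip (a ∷ p) (p ++ [ z ]) → Step (a ∷ p) x y ⊎ (x ≡ b × y ≡ z)
  zip⁻ stop                (here refl) = inj₂ (refl , refl)
  zip⁻ (go _ stop)         (here refl) = inj₁ here
  zip⁻ (go _ (go _ _))     (here refl) = inj₁ here
  zip⁻ (go _ w@stop)       (there i)   = Sum.map₁ there (zip⁻ w i)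
  zip⁻ (go _ w@(go _ _))   (there i)   = Sum.map₁ there (zip⁻ w i)

  cyclePairs⁻ : ∀ {a b x y : A} {p} → Walk a b p → (x , y) ∈ cyclePairs p → Step p x y ⊎ (x ≡ b × y ≡ a)
  cyclePairs⁻ w@stop     = zip⁻ w
  cyclePairs⁻ w@(go _ _) = zip⁻ w

  zip⁺ : ∀ {a b x y z : A} {p} → Walk a b (a ∷ p) → Step (a ∷ p) x y ⊎ (x ≡ b × y ≡ z) → (x , y) ∈ zip (a ∷ p) (p ++ [ z ])
  zip⁺ stop              (inj₁ (there ()))
  zip⁺ stop              (inj₂ (refl , refl)) = here refl
  zip⁺ (go _ _)          (inj₁ here)          = here refl
  zip⁺ (go _ w@stop)     (inj₁ (there s))     = there (zip⁺ w (inj₁ s))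
  zip⁺ (go _ w@(go _ _)) (inj₁ (there s))     = there (zip⁺ w (inj₁ s))
  zip⁺ (go _ w@stop)     (inj₂ e)             = there (zip⁺ w (inj₂ e))
  zip⁺ (go _ w@(go _ _)) (inj₂ e)             = there (zip⁺ w (inj₂ e))

  cyclePairs⁺ : ∀ {a b x y : A} {p} → Walk a b p → Step p x y ⊎ (x ≡ b × y ≡ a) → (x , y) ∈ cyclePairs p
  cyclePairs⁺ w@stop     = zip⁺ w
  cyclePairs⁺ w@(go _ _) = zip⁺ w

unique-map : ∀ {A B : Set} (f : A → B) {p} → (∀ {x y} → x ∈ p → y ∈ p → f x ≡ f y → x ≡ y) → Unique p → Unique (map f p)
unique-map f inj []       = []
unique-map f {x ∷ p} inj (x∉ ∷ u) = All.tabulate fresh ∷ unique-map f (λ i j → inj (there i) (there j)) u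
  where
  fresh : ∀ {y} → y ∈ map f p → f x ≢ y
  fresh i eq with ∈-map⁻ f i
  ... | z , z∈ , refl = All.lookup x∉ z∈ (inj (here refl) (there z∈) eq)

-- From glued cycles to cycles of subsets.

path-length : ∀ x {p} → p ∈ path x → length (encode p) ≡ oddN (size x)
path-length x {g , s} p∈ with path-weight x p∈
... | o≡ , z≡ = trans (encode-length g s) (cong suc (trans (length-split s) (trans (cong (_+ zeros s) o≡)
    (trans (cong (_+ zeros s) (+-comm (excess g) (size x))) (trans (+-assoc (size x) (excess g) (zeros s))
      (cong (size x +_) (trans z≡ (sym (+-identityʳ (size x))))))))))
  where
  encode-length : ∀ g s → length (encode (g , s)) ≡ suc (length s)
  encode-length false s = refl
  encode-length true  s = cong suc (length-map not s)

path-ones : ∀ x {p} → p ∈ path x → ones (encode p) ≡ size x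
path-ones x {false , s} p∈ = proj₁ (path-weight x p∈)
path-ones x {true  , s} p∈ = trans (cong suc (ones-not s)) (proj₂ (path-weight x p∈))

subset : ∀ k → Vertex → Subset (oddN k)
subset k p = toVec (oddN k) (encode p)

-- By `path-length` both encodings have length exactly `oddN k`, so `toVec` neither pads nor
-- truncates.
subset-injective : ∀ {k x y p q} → size x ≡ k → size y ≡ k → p ∈ path x → q ∈ path y → subset k p ≡ subset k q → p ≡ q
subset-injective {k} {x} {y} {p} {q} refl y≡ p∈ q∈ eq =
  encode-injective p q (trans (sym (recover p (path-length x p∈)))
    (trans (cong toList eq) (recover q (trans (path-length y q∈) (cong oddN y≡)))))
  where
  recover : ∀ {n} p → length (encode p) ≡ n → toList (toVec n (encode p)) ≡ encode p
  recover p refl = toList-toVec (encode p)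

vertex : ∀ {n} → Vec Bool (suc n) → Vertex
vertex (false ∷ v) = false , toList v
vertex (true  ∷ v) = true , map not (toList v)

encode-vertex : ∀ {n} (v : Vec Bool (suc n)) → encode (vertex v) ≡ toList v
encode-vertex (false ∷ v) = refl
encode-vertex (true  ∷ v) = cong (true ∷_) (map-not-not (toList v))

vertex-level : ∀ {k} (v : Subset (oddN k)) → ∣ v ∣ ≡ k → Level (vertex v)
vertex-level {k} (false ∷ v) eq with toList-weights v
... | o≡ , l≡ = sym (+-cancelˡ-≡ k _ _ (trans (trans (cong (_+ zeros (toList v)) (sym (trans o≡ eq))) l≡) (cong (k +_) (trans (+-identityʳ k) (sym (trans o≡ eq))))))
vertex-level {suc k} (true ∷ v) eq with toList-weights v
... | o≡ , l≡ = trans (ones-not (toList v)) (trans (+-cancelˡ-≡ k _ _ (trans (trans (cong (_+ zeros (toList v)) (sym o≡k)) l≡)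
      (trans (cong suc (cong (k +_) (cong suc (trans (+-identityʳ k) (sym o≡k))))) (sym (+-suc k (suc (ones (toList v))))))))
      (cong (2 +_) (sym (zeros-not (toList v)))))
  where
  o≡k : ones (toList v) ≡ k
  o≡k = trans o≡ (suc-injective eq)

vertex-covered : ∀ {k} (v : Subset (oddN k)) → ∣ v ∣ ≡ k → ∃ λ x → size x ≡ k × vertex v ∈ path x
vertex-covered {k} v eq with covered _ _ _ ≤-refl (vertex-level v eq)
... | x , p∈ = x , trans (sym (path-ones x p∈)) (trans (cong ones (encode-vertex v)) (trans (proj₁ (toList-weights v)) eq)) , p∈

module _ {k : ℕ} {A M : Marks} (Z : Cycle (Size k) A M) where
  open Cycle Z

  subset-walk : Walk (subset k first) (subset k last) (map (subset k) list)
  subset-walk = walk-map (subset k) walk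

  subset-pairs : ∀ {s t} → (s , t) ∈ cyclePairs (map (subset k) list) → ∃ λ p → ∃ λ q → Cyclic first last list p q × s ≡ subset k p × t ≡ subset k q
  subset-pairs i with cyclePairs⁻ subset-walk i
  ... | inj₂ (s≡ , t≡) = last , first , inj₂ (inj₁ (refl , refl)) , s≡ , t≡
  ... | inj₁ s with step-map⁻ (subset k) list s
  ...   | p , q , s' , eqs = p , q , inj₁ (inj₁ s') , eqs

  hamilton : HamiltonCycle (oddN k) k
  hamilton = record
    { seq      = map (subset k) list
    ; vertices = All.tabulate is-vertex
    ; unique   = unique-map (subset k) (λ i j eq → let x , x≡ , p∈ = ∈⇒ i ; y , y≡ , q∈ = ∈⇒ j in subset-injective x≡ y≡ p∈ q∈ eq) simple
    ; covers   = λ s eq → let x , x≡ , p∈ = vertex-covered s eq in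
        subst (_∈ map (subset k) list) (trans (cong (toVec (oddN k)) (encode-vertex s)) (toVec-toList s)) (∈-map⁺ (subset k) (∈⇐ x≡ p∈))
    ; adjacent = All.tabulate are-adjacent
    }
    where
    is-vertex : ∀ {s} → s ∈ map (subset k) list → IsVertex (oddN k) k s
    is-vertex i with ∈-map⁻ (subset k) i
    ... | p , p∈ , refl with ∈⇒ p∈
    ...   | x , refl , q∈ = trans (cong (λ n → ∣ toVec n (encode p) ∣) (sym (path-length x q∈))) (trans (toVec-size (encode p)) (path-ones x q∈))
    are-adjacent : ∀ {st} → st ∈ cyclePairs (map (subset k) list) → uncurry Adjacent st
    are-adjacent i with subset-pairs i
    ... | p , q , c , refl , refl = toVec-disjoint (oddN k) (encode-adj (adj c))

  uses⁺ : ∀ {p q} → Cyclic first last list p q → UsesEdge hamilton (subset k p) (subset k q)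
  uses⁺ (inj₁ (inj₁ s))             = inj₁ (cyclePairs⁺ subset-walk (inj₁ (step-map (subset k) s)))
  uses⁺ (inj₁ (inj₂ s))             = inj₂ (cyclePairs⁺ subset-walk (inj₁ (step-map (subset k) s)))
  uses⁺ (inj₂ (inj₁ (refl , refl))) = inj₁ (cyclePairs⁺ subset-walk (inj₂ (refl , refl)))
  uses⁺ (inj₂ (inj₂ (refl , refl))) = inj₂ (cyclePairs⁺ subset-walk (inj₂ (refl , refl)))

  cyclic-∈ : ∀ {p q} → Cyclic first last list p q → p ∈ list × q ∈ list
  cyclic-∈ (inj₁ (inj₁ s))             = step-∈ˡ s , step-∈ʳ s
  cyclic-∈ (inj₁ (inj₂ s))             = step-∈ʳ s , step-∈ˡ s
  cyclic-∈ (inj₂ (inj₁ (refl , refl))) = last∈ walk , first∈ walk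
  cyclic-∈ (inj₂ (inj₂ (refl , refl))) = first∈ walk , last∈ walk

  -- Membership in `path x` is what allows `subset` to be inverted at `p` and `q`.
  uses⁻ : ∀ {x p q} → size x ≡ k → p ∈ path x → q ∈ path x → UsesEdge hamilton (subset k p) (subset k q) → Cyclic first last list p q
  uses⁻ {x} x≡ p∈ q∈ (inj₁ i) with subset-pairs i
  ... | p' , q' , c , s≡ , t≡ with cyclic-∈ c
  ...   | p'∈ , q'∈ with ∈⇒ p'∈ | ∈⇒ q'∈
  ...     | _ , y≡ , i' | _ , z≡ , j' with subset-injective x≡ y≡ p∈ i' s≡ | subset-injective x≡ z≡ q∈ j' t≡
  ...       | refl | refl = c
  uses⁻ {x} x≡ p∈ q∈ (inj₂ i) with uses⁻ x≡ q∈ p∈ (inj₁ i)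
  ... | inj₁ e              = inj₁ (Sum.swap e)
  ... | inj₂ (inj₁ (a , b)) = inj₂ (inj₂ (b , a))
  ... | inj₂ (inj₂ (a , b)) = inj₂ (inj₁ (b , a))

-- Telling the Hamilton cycles apart.

same-marks : ∀ {k A A' M M'} (Z : Cycle (Size k) A M) (Z' : Cycle (Size k) A' M') → SameCycle (hamilton Z) (hamilton Z') →
  ∀ x e → Size k x → M x e → A' x e → ⊥
same-marks {k} Z Z' sc x e x≡ μ α = Cycle.used Z x e x≡ μ
  (uses⁻ Z x≡ (lo∈ e) (hi∈ e) (proj₂ (sc _ _) (uses⁺ Z' (Cycle.avail Z' x e x≡ α))))

marking-size : ∀ n c γ x e → Marking n c γ x e → Size (4 + n) x
marking-size zero    c       γ _ _ (base (_ , same)) = refl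
marking-size (suc n) (c , d) γ _ _ (base m) = cong suc (marking-size n c γ _ _ m)
marking-size (suc n) (c , d) γ _ _ (top {u} m)  = cong suc (trans (+-identityʳ (size u)) (marking-size n d γ _ _ m))

-- Where two choices differ in a bit, the slot of that bit is used up by one and available in the
-- other; the two hypotheses cover the two directions.
separate : ∀ n c d → (∀ x e → Marking n c true x e → Marking n d false x e → ⊥) → (∀ x e → Marking n d true x e → Marking n c false x e → ⊥) → c ≡ d
separate zero false false _ _ = refl
separate zero true  true  _ _ = refl
separate zero true  false f _ = ⊥-elim (f _ _ (base (refl , same)) (base (refl , same)))
separate zero false true  _ f = ⊥-elim (f _ _ (base (refl , same)) (base (refl , same)))
separate (suc n) (c , c') (d , d') f g = cong₂ _,_
  (separate n c d (λ x e m m' → f _ _ (base m) (base m')) (λ x e m m' → g _ _ (base m) (base m')))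
  (separate n c' d' (λ x e m m' → f _ _ (top m) (top m')) (λ x e m m' → g _ _ (top m) (top m')))

double : ∀ n → 2 ^ (2 ^ suc n) ≡ 2 ^ (2 ^ n) * 2 ^ (2 ^ n)
double n = trans (cong (λ z → 2 ^ (2 ^ n + z)) (+-identityʳ (2 ^ n))) (^-distribˡ-+-* 2 (2 ^ n) (2 ^ n))

bits : ∀ n → Fin (2 ^ (2 ^ n)) → Bits n
bits zero    zero    = false
bits zero    (suc _) = true
bits (suc n) i       = let q , r = remQuot (2 ^ (2 ^ n)) (subst Fin (double n) i) in bits n q , bits n r

bits-injective : ∀ n i j → bits n i ≡ bits n j → i ≡ j
bits-injective zero zero zero _ = refl
bits-injective zero (suc zero) (suc zero) _ = refl
bits-injective (suc n) i j eq = subst-injective (double n) (trans (sym (combine-remQuot {N} N (subst Fin (double n) i)))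
    (trans (cong₂ combine (bits-injective n _ _ (cong proj₁ eq)) (bits-injective n _ _ (cong proj₂ eq)))
           (combine-remQuot {N} N (subst Fin (double n) j))))
  where
  N : ℕ
  N = 2 ^ (2 ^ n)

theorem3 : (k : ℕ) → 6 ≤ k →
    Σ (Fin (2 ^ (2 ^ (k ∸ 6))) → HamiltonCycle (oddN k) k)
    (λ C → ∀ i j → SameCycle (C i) (C j) → i ≡ j)
theorem3 _ (s≤s (s≤s (s≤s (s≤s (s≤s (s≤s (z≤n {n}))))))) = (λ i → hamilton (Z i)) , distinct
  where
  choice : Fin (2 ^ (2 ^ n)) → Bits (2 + n)
  -- With k = 6 + n there are 2^(2+n) free bits, four times the 2^n that index the required cycles;
  -- all four quarters receive the same bits.
  choice i = (bits n i , bits n i) , (bits n i , bits n i)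
  Z : ∀ i → Cycle (Size (6 + n)) (Marking (2 + n) (choice i) false) (Marking (2 + n) (choice i) true)
  Z i = cycle (Stratum.whole (stratum (2 + n)) (choice i))
  distinct : ∀ i j → SameCycle (hamilton (Z i)) (hamilton (Z j)) → i ≡ j
  distinct i j sc = bits-injective n i j (cong (λ c → proj₁ (proj₁ c)) (separate (2 + n) (choice i) (choice j)
    (λ x e m m' → same-marks (Z i) (Z j) sc x e (marking-size (2 + n) (choice i) true x e m) m m')
    (λ x e m m' → same-marks (Z j) (Z i) (λ u v → proj₂ (sc u v) , proj₁ (sc u v)) x e (marking-size (2 + n) (choice j) true x e m) m m')))
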